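{- For every odd integer $m = 2k+1$ with $m \geq 5$, the pebbling number of the Flower graph $J_m$ satisfies $$\pi(J_m) \leq \left\lfloor \tfrac{8}{5} \cdot 2^{k+2} + 2k - \tfrac{8}{5} \right\rfloor + 1.$$ In particular, $\pi(J_5) \leq 29$ and $\pi(J_7) \leq 56$.
   Context: Flower graphs. For odd $m = 2k+1 \geq 3$, the Flower graph $J_m$ is the simple graph with $4m$ vertices $v_i, x_i, y_i, z_i$ for $i \in \{ -k, \ldots, -1, 0, 1, \ldots, k\}$ and the following edges: $z_iv_i$, $z_ix_i$, $z_iy_i$ for each $i \in \{ -k,\ldots,k\}$; $v_iv_{i+1}$, $x_ix_{i+1}$, $y_iy_{i+1}$ for each $i \in \{ -k, \ldots, k-1\}$; the edge $v_kv_{ -k}$ (so the vertices $v_i$ form a cycle of length $m$); and the edges $x_ky_{ -k}$ and $y_kx_{ -k}$ (so the vertices $x_i$ and $y_i$ together form a cycle of length $2m$). Graph pebbling. A configuration on a graph $G$ is a function $C : V(G) \to \mathbb{N}$ (with $0 \in \mathbb{N}$), where $C(v)$ is the number of pebbles at $v$; its size is $|C| = \sum_{v \in V(G)} C(v)$. A pebbling move removes 2 pebbles from a vertex $v$ (having at least 2 pebbles) and adds 1 pebble to a vertex adjacent to $v$. For $r \in V(G)$, a configuration is $r$-solvable if some (possibly empty) finite sequence of pebbling moves results in at least one pebble on $r$. For a target $r$, $\pi(G,r)$ is the minimum number $t$ such that every configuration with $t$ pebbles is $r$-solvable. The pebbling number is $\pi(G) = \max_{r \in V(G)} \pi(G,r)$,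 i.e. the minimum $t$ such that every configuration with $t$ pebbles is $r$-solvable for every $r \in V(G)$. -}

module Defs where

open import Data.Fin.Base using (Fin; toℕ)
open import Data.Integer.Base as ℤ using (ℤ; +_)
open import Data.List.Base using (List; _++_; map; allFin)
open import Data.List.Membership.Propositional using (_∈_)
open import Data.List.Membership.Propositional.Properties
  using (∈-map⁺; ∈-map⁻; ∈-++⁺ˡ; ∈-++⁺ʳ; ∈-++⁻; ∈-allFin)
open import Data.List.Relation.Unary.Unique.Propositional using (Unique)
import Data.List.Relation.Unary.Unique.Propositional.Properties as Unique
open import Data.Nat.Base using (ℕ; suc; _+_; _*_; _^_; _≤_; _≥_)
open import Data.Nat.ListAction using (sum)
open import Data.Product.Base using (∃-syntax; _×_; _,_)
open import Data.Rational.Unnormalised.Base as ℚᵘ using (_/_)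
open import Data.Sum.Base using (_⊎_; inj₁; inj₂; swap)
open import Relation.Binary.Construct.Closure.ReflexiveTransitive using (Star)
open import Relation.Binary.PropositionalEquality
  using (_≡_; _≢_; refl; ≢-sym)
open import Relation.Nullary.Negation using (¬_)

record Graph : Set₁ where
  field
    Vertex   : Set
    vertices : List Vertex
    complete : ∀ u → u ∈ vertices
    unique   : Unique vertices
    Adj      : Vertex → Vertex → Set
    adj-sym  : ∀ {u w} → Adj u w → Adj w u
    irrefl   : ∀ {u} → ¬ Adj u u

module _ (G : Graph) where
  open Graph G

  Configuration : Set
  Configuration = Vertex → ℕ

  size : Configuration → ℕ
  size C = sum (map C vertices)

  -- C′ is what is left of C after moving from u to w.  The first equation
  -- also says that C has at least 2 pebbles at u; u and w are distinct
  -- because they are adjacent.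
  record Move (C C′ : Configuration) : Set where
    field
      u w      : Vertex
      adjacent : Adj u w
      at-u     : C u ≡ 2 + C′ u
      at-w     : C′ w ≡ 1 + C w
      at-rest  : ∀ a → a ≢ u → a ≢ w → C′ a ≡ C a

  Solvable : Vertex → Configuration → Set
  Solvable r C = ∃[ C′ ] (Star Move C C′ × C′ r ≥ 1)

  AllSolvable : ℕ → Set
  AllSolvable t = ∀ r C → size C ≡ t → Solvable r C

  record IsPebblingNumber (t : ℕ) : Set where
    field
      allSolvable : AllSolvable t
      minimum     : ∀ s → AllSolvable s → t ≤ s

-- For m = 2k+1, the element j of Fin m stands for the index j − k in
-- {−k, …, k}: First holds of −k only, Last of k only, and Next i j says
-- that j is the index following i.

module _ {m : ℕ} where

  First Last : Fin m → Set
  First i = toℕ i ≡ 0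
  Last  i = suc (toℕ i) ≡ m

  Next : Fin m → Fin m → Set
  Next i j = toℕ j ≡ suc (toℕ i)

data FlowerVertex (m : ℕ) : Set where
  v x y z : Fin m → FlowerVertex m

data FlowerEdge {m : ℕ} : FlowerVertex m → FlowerVertex m → Set where
  zv : ∀ i → FlowerEdge (z i) (v i)
  zx : ∀ i → FlowerEdge (z i) (x i)
  zy : ∀ i → FlowerEdge (z i) (y i)
  vv : ∀ {i j} → Next i j → FlowerEdge (v i) (v j)
  xx : ∀ {i j} → Next i j → FlowerEdge (x i) (x j)
  yy : ∀ {i j} → Next i j → FlowerEdge (y i) (y j)
  vv-close : ∀ {i j} → Last i → First j → FlowerEdge (v i) (v j)
  xy-close : ∀ {i j} → Last i → First j → FlowerEdge (x i) (y j)
  yx-close : ∀ {i j} → Last i → First j → FlowerEdge (y i) (x j)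

flowerVertices : ∀ m → List (FlowerVertex m)
flowerVertices m =
  map v (allFin m) ++ map x (allFin m) ++ map y (allFin m) ++ map z (allFin m)

flowerVertices-complete : ∀ {m} (u : FlowerVertex m) → u ∈ flowerVertices m
flowerVertices-complete (v i) = ∈-++⁺ˡ (∈-map⁺ v (∈-allFin i))
flowerVertices-complete {m} (x i) =
  ∈-++⁺ʳ (map v (allFin m)) (∈-++⁺ˡ (∈-map⁺ x (∈-allFin i)))
flowerVertices-complete {m} (y i) =
  ∈-++⁺ʳ (map v (allFin m)) (∈-++⁺ʳ (map x (allFin m))
    (∈-++⁺ˡ (∈-map⁺ y (∈-allFin i))))
flowerVertices-complete {m} (z i) =
  ∈-++⁺ʳ (map v (allFin m)) (∈-++⁺ʳ (map x (allFin m))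
    (∈-++⁺ʳ (map y (allFin m)) (∈-map⁺ z (∈-allFin i))))

flowerVertices-unique : ∀ m → Unique (flowerVertices m)
flowerVertices-unique m =
  Unique.++⁺ (Unique.map⁺ (λ { refl → refl }) fins)
    (Unique.++⁺ (Unique.map⁺ (λ { refl → refl }) fins)
      (Unique.++⁺ (Unique.map⁺ (λ { refl → refl }) fins)
        (Unique.map⁺ (λ { refl → refl }) fins)
        (λ { (p , q) → y∉z p q }))
      (λ { (p , q) → x∉yz p q }))
    (λ { (p , q) → v∉xyz p q })
  where
  fins : Unique (allFin m)
  fins = Unique.allFin⁺ m

  y∉z : ∀ {u} → u ∈ map y (allFin m) → ¬ u ∈ map z (allFin m)
  y∉z p q with ∈-map⁻ y p | ∈-map⁻ z q
  ... | _ , _ , refl | _ , _ , ()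

  x∉yz : ∀ {u} → u ∈ map x (allFin m) →
         ¬ u ∈ map y (allFin m) ++ map z (allFin m)
  x∉yz p q with ∈-map⁻ x p | ∈-++⁻ (map y (allFin m)) q
  ... | _ , _ , refl | inj₁ q′ with ∈-map⁻ y q′
  ...   | _ , _ , ()
  x∉yz p q | _ , _ , refl | inj₂ q′ with ∈-map⁻ z q′
  ...   | _ , _ , ()

  v∉xyz : ∀ {u} → u ∈ map v (allFin m) →
          ¬ u ∈ map x (allFin m) ++ map y (allFin m) ++ map z (allFin m)
  v∉xyz p q with ∈-map⁻ v p | ∈-++⁻ (map x (allFin m)) q
  ... | _ , _ , refl | inj₁ q′ with ∈-map⁻ x q′
  ...   | _ , _ , ()
  v∉xyz p q | _ , _ , refl | inj₂ q′ with ∈-++⁻ (map y (allFin m)) q′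
  ... | inj₁ q″ with ∈-map⁻ y q″
  ...   | _ , _ , ()
  v∉xyz p q | _ , _ , refl | inj₂ q′ | inj₂ q″ with ∈-map⁻ z q″
  ...   | _ , _ , ()

-- J m is the Flower graph for odd m ≥ 3.  The condition u ≢ w excludes only
-- the loop that vv-close would give when m = 1; it holds of every FlowerEdge
-- when m ≥ 2.
J : ℕ → Graph
J m = record
  { Vertex   = FlowerVertex m
  ; vertices = flowerVertices m
  ; complete = flowerVertices-complete
  ; unique   = flowerVertices-unique m
  ; Adj      = λ u w → u ≢ w × (FlowerEdge u w ⊎ FlowerEdge w u)
  ; adj-sym  = λ { (u≢w , e) → ≢-sym u≢w , swap e }
  ; irrefl   = λ { (u≢u , _) → u≢u refl }
  }

flowerBound : ℕ → ℤ
flowerBound k =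
  ℚᵘ.floor ((+ 8 / 5) ℚᵘ.* (+ (2 ^ (k + 2)) / 1)
            ℚᵘ.+ (+ (2 * k) / 1) ℚᵘ.- (+ 8 / 5))
  ℤ.+ + 1

{-# OPTIONS --safe #-}

-- Call f : V → ℕ valid for the root r if every u with f u > 0 has a neighbour p
-- with p = r or f p ≥ 2 f u.  Moving pebbles from such u to p never lowers
-- Σ f C, so either r is reached or the play ends with at most one pebble on each
-- u with f u > 0; hence every unsolvable C has Σ f C ≤ Σ f.  This passes to sums
-- F of valid functions, and if F ≥ D off r then every C with D |C| > Σ F is
-- solvable.  For J_m, with e the number of steps from index i to the end ±k on
-- its side (so 2^e halves at each step away from the centre), suitable sums of
-- three valid functions for a root with index 0 are:
--   * root z₀, D = 6, Σ F = 36·2^k + 12k − 12: one function for each of the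
--     lines v, x, y, equal to 4·2^e on that line;
--   * root v₀, x₀ or y₀, D = 4, Σ F = 24·2^k + 8k: one function entering the two
--     other lines through z₀, equal to 2^e there, and for each side one function
--     running along the root's line, equal to 8·2^e, which crosses over at the
--     end to the opposite side.
-- Thus 6·2^k + 2k + 1 pebbles suffice.  The rotation of J_m moves every root to
-- index 0.

module Submission where

open import Defs
open import Data.Fin.Base using (Fin; zero; suc; toℕ; fromℕ; fromℕ<; inject₁)
import Data.Fin.Properties as Fin
open import Data.Fin.Properties using (toℕ-injective; toℕ-fromℕ; toℕ-fromℕ<; toℕ-inject₁; toℕ<n)
open import Data.Fin.Relation.Unary.Top using (view; view-fromℕ; view-inject₁; ‵fromℕ; ‵inject₁)
open import Data.Integer.Base as ℤ using (ℤ)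
import Data.Integer.DivMod as ℤ
import Data.Integer.Properties as ℤ
import Data.Integer.Tactic.RingSolver as ℤ-Solver
open import Data.List.Base using (List; []; _∷_; _++_; map; reverse; allFin; tabulate; applyUpTo; applyDownFrom)
open import Data.List.Membership.Propositional using (_∈_; find; lose)
open import Data.List.Membership.Propositional.Properties using (∈-map⁺)
open import Data.List.Membership.Propositional.Properties.WithK using (unique∧set⇒bag)
open import Data.List.Properties using (map-cong; map-∘; map-++; map-tabulate; reverse-applyUpTo)
open import Data.List.Relation.Binary.BagAndSetEquality using (∼bag⇒↭)
open import Data.List.Relation.Binary.Permutation.Propositional.Properties using (map⁺; ↭-reverse)
open import Data.List.Relation.Unary.All as All using (All; []; _∷_)
open import Data.List.Relation.Unary.All.Properties using (¬All⇒Any¬)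
open import Data.List.Relation.Unary.AllPairs using (_∷_)
open import Data.List.Relation.Unary.Any using (here; there; any?)
open import Data.List.Relation.Unary.Unique.Propositional using (Unique)
import Data.List.Relation.Unary.Unique.Propositional.Properties as Unique
open import Data.Nat.Base using (ℕ; zero; suc; _+_; _*_; _∸_; _^_; _≤_; _<_; _≥_; z≤n; s≤s; z<s; s<s; s≤s⁻¹)
open import Data.Nat.ListAction using (sum)
open import Data.Nat.ListAction.Properties using (sum-↭; sum-++)
open import Data.Nat.Properties
open import Data.Nat.Tactic.RingSolver using (solve-∀)
open import Data.Product.Base using (∃-syntax; _×_; _,_; proj₁; proj₂)
open import Data.Rational.Unnormalised.Base as ℚᵘ using (ℚᵘ; floor; ↥_; ↧_)
open import Data.Sum.Base as Sum using (_⊎_; inj₁; inj₂)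
open import Function.Base using (_∘_; _$_)
open import Function.Bundles using (mk⇔)
open import Relation.Binary.Construct.Closure.ReflexiveTransitive using (ε; _◅_)
open import Relation.Binary.Definitions using (DecidableEquality; Decidable; tri<; tri≈; tri>)
open import Relation.Binary.PropositionalEquality hiding (J)
open import Relation.Nullary.Decidable using (Dec; yes; no; map′; _×-dec_; _⊎-dec_; ¬?)
open import Relation.Nullary.Negation using (contradiction)
import Relation.Unary as U

-- An upper bound for the pebbling number only supplies some `t` with `AllSolvable`. Constructively,
-- the least such `t` exists once `AllSolvable` is decidable, which the decision procedures below
-- establish.
least : {P : ℕ → Set} → U.Decidable P → ∀ n → P n →
        ∃[ t ] (P t × (∀ s → P s → t ≤ s) × t ≤ n)
least P? n Pn with P? 0
... | yes P0 = 0 , P0 , (λ _ _ → z≤n) , z≤n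
least P? zero    P0 | no ¬P0 = contradiction P0 ¬P0
least P? (suc n) Pn | no ¬P0 with least (P? ∘ suc) n Pn
... | t , Pt , t-min , t≤n = suc t , Pt , minimal , s≤s t≤n
  where
  minimal : ∀ s → _ → suc t ≤ s
  minimal zero    P0 = contradiction P0 ¬P0
  minimal (suc s) Ps = s≤s (t-min s Ps)

-- Finite sums and indicator functions

module _ {A : Set} where

  sum-map-+ : ∀ (f g : A → ℕ) as →
              sum (map (λ a → f a + g a) as) ≡ sum (map f as) + sum (map g as)
  sum-map-+ f g []       = refl
  sum-map-+ f g (a ∷ as) = begin
    f a + g a + sum (map (λ b → f b + g b) as)       ≡⟨ cong (λ n → f a + g a + n) (sum-map-+ f g as) ⟩
    f a + g a + (sum (map f as) + sum (map g as))     ≡⟨ regroup (f a) (g a) _ _ ⟩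
    f a + sum (map f as) + (g a + sum (map g as))     ∎
    where
    open ≡-Reasoning
    regroup : ∀ p q r s → p + q + (r + s) ≡ p + r + (q + s)
    regroup = solve-∀

  sum-map-* : ∀ c (f : A → ℕ) as → sum (map (λ a → c * f a) as) ≡ c * sum (map f as)
  sum-map-* c f []       = sym (*-zeroʳ c)
  sum-map-* c f (a ∷ as) = trans (cong (c * f a +_) (sum-map-* c f as))
                                 (sym (*-distribˡ-+ c (f a) (sum (map f as))))

  sum-map-mono : ∀ {f g : A → ℕ} {as} → All (λ a → f a ≤ g a) as →
                 sum (map f as) ≤ sum (map g as)
  sum-map-mono []              = z≤n
  sum-map-mono (fa≤ga ∷ f≤g) = +-mono-≤ fa≤ga (sum-map-mono f≤g)

module Indicator {A : Set} (_≟_ : DecidableEquality A) where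

  δ : A → A → ℕ
  δ a b with a ≟ b
  ... | yes _ = 1
  ... | no  _ = 0

  δ-refl : ∀ a → δ a a ≡ 1
  δ-refl a with a ≟ a
  ... | yes _  = refl
  ... | no a≢a = contradiction refl a≢a

  δ-≢ : ∀ {a b} → a ≢ b → δ a b ≡ 0
  δ-≢ {a} {b} a≢b with a ≟ b
  ... | yes a≡b = contradiction a≡b a≢b
  ... | no  _   = refl

  sum-δ-∉ : ∀ (f : A → ℕ) {a as} → All (a ≢_) as → sum (map (λ b → f b * δ a b) as) ≡ 0
  sum-δ-∉ f []                 = refl
  sum-δ-∉ f {a} {b ∷ _} (a≢b ∷ a∉) =
    cong₂ _+_ (trans (cong (f b *_) (δ-≢ a≢b)) (*-zeroʳ (f b))) (sum-δ-∉ f a∉)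

  sum-δ : ∀ (f : A → ℕ) {a as} → Unique as → a ∈ as → sum (map (λ b → f b * δ a b) as) ≡ f a
  sum-δ f {a} (a∉ ∷ _) (here refl) =
    trans (cong₂ _+_ (trans (cong (f a *_) (δ-refl a)) (*-identityʳ (f a))) (sum-δ-∉ f a∉))
          (+-identityʳ (f a))
  sum-δ f {a} {b ∷ _} (b∉ ∷ u) (there a∈) =
    cong₂ _+_ (trans (cong (f b *_) (δ-≢ (All.lookup b∉ a∈ ∘ sym))) (*-zeroʳ (f b)))
              (sum-δ f u a∈)

-- Weight functions and pebbling moves on an arbitrary graph

module Pebbling (G : Graph) (_≟_ : DecidableEquality (Graph.Vertex G)) where

  open Graph G
  open Indicator _≟_

  weighted : (Vertex → ℕ) → Configuration G → ℕ
  weighted f C = size G (λ a → f a * C a)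

  size-cong : ∀ {C C′ : Configuration G} → C ≗ C′ → size G C ≡ size G C′
  size-cong C≗C′ = cong sum (map-cong C≗C′ vertices)

  size-δ : ∀ f u → weighted f (δ u) ≡ f u
  size-δ f u = sum-δ f unique (complete u)

  size-mono : ∀ {C C′ : Configuration G} → (∀ a → C a ≤ C′ a) → size G C ≤ size G C′
  size-mono C≤C′ = sum-map-mono (All.universal C≤C′ vertices)

  weighted-+ : ∀ f C C′ → weighted f (λ a → C a + C′ a) ≡ weighted f C + weighted f C′
  weighted-+ f C C′ = trans (size-cong (λ a → *-distribˡ-+ (f a) (C a) (C′ a)))
                            (sum-map-+ _ _ vertices)

  weighted-1 : ∀ C → weighted (λ _ → 1) C ≡ size G C
  weighted-1 C = size-cong (λ a → *-identityˡ (C a))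

  -- The three cases of a move become one subtraction-free linear identity. Summing it against `f`
  -- gives `move-weighted`, and it determines `C′` pointwise from `C`, `u` and `w`, as `firstMove`
  -- requires.
  move-balance : ∀ {C C′} (mv : Move G C C′) → let open Move mv in
                 ∀ a → C′ a + (δ u a + δ u a) ≡ C a + δ w a
  move-balance {C} {C′} mv a with Move.u mv ≟ a | Move.w mv ≟ a
  ... | yes refl | yes refl = contradiction (Move.adjacent mv) irrefl
  ... | yes refl | no _     =
    trans (+-comm (C′ a) 2) (trans (sym (Move.at-u mv)) (sym (+-identityʳ (C a))))
  ... | no _     | yes refl =
    trans (+-identityʳ (C′ a)) (trans (Move.at-w mv) (+-comm 1 (C a)))
  ... | no u≢a   | no w≢a   = cong (_+ 0) (Move.at-rest mv a (u≢a ∘ sym) (w≢a ∘ sym))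

  move-weighted : ∀ f {C C′} (mv : Move G C C′) → let open Move mv in
                  weighted f C′ + (f u + f u) ≡ weighted f C + f w
  move-weighted f {C} {C′} mv = begin
    weighted f C′ + (f u + f u)
      ≡⟨ cong (weighted f C′ +_) (cong₂ _+_ (size-δ f u) (size-δ f u)) ⟨
    weighted f C′ + (weighted f (δ u) + weighted f (δ u))
      ≡⟨ cong (weighted f C′ +_) (weighted-+ f (δ u) (δ u)) ⟨
    weighted f C′ + weighted f (λ a → δ u a + δ u a)
      ≡⟨ weighted-+ f C′ _ ⟨
    weighted f (λ a → C′ a + (δ u a + δ u a))
      ≡⟨ size-cong (λ a → cong (f a *_) (move-balance mv a)) ⟩
    weighted f (λ a → C a + δ w a)
      ≡⟨ weighted-+ f C (δ w) ⟩
    weighted f C + weighted f (δ w)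
      ≡⟨ cong (weighted f C +_) (size-δ f w) ⟩
    weighted f C + f w ∎
    where
    open ≡-Reasoning
    open Move mv

  move-size : ∀ {C C′} → Move G C C′ → size G C ≡ suc (size G C′)
  move-size {C} {C′} mv = suc-injective (begin
    suc (size G C)               ≡⟨ +-comm 1 (size G C) ⟩
    size G C + 1                 ≡⟨ cong (_+ 1) (weighted-1 C) ⟨
    weighted (λ _ → 1) C + 1     ≡⟨ move-weighted (λ _ → 1) mv ⟨
    weighted (λ _ → 1) C′ + 2    ≡⟨ cong (_+ 2) (weighted-1 C′) ⟩
    size G C′ + 2                ≡⟨ +-comm (size G C′) 2 ⟩
    suc (suc (size G C′))        ∎)
    where open ≡-Reasoning

  -- The truncated subtraction is exact wherever a move takes place, because `pebble-move` assumes
  -- `2 ≤ C u`.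
  pebble : Configuration G → Vertex → Vertex → Configuration G
  pebble C u w a with a ≟ u | a ≟ w
  ... | yes _ | _     = C a ∸ 2
  ... | no _  | yes _ = suc (C a)
  ... | no _  | no _  = C a

  pebble-move : ∀ C {u w} → Adj u w → 2 ≤ C u → Move G C (pebble C u w)
  pebble-move C {u} {w} uw 2≤Cu = record
    { u = u ; w = w ; adjacent = uw ; at-u = at-u ; at-w = at-w ; at-rest = at-rest }
    where
    at-u : C u ≡ 2 + pebble C u w u
    at-u with u ≟ u | u ≟ w
    ... | yes _  | _ = sym (m+[n∸m]≡n 2≤Cu)
    ... | no u≢u | _ = contradiction refl u≢u

    at-w : pebble C u w w ≡ 1 + C w
    at-w with w ≟ u | w ≟ w
    ... | yes refl | _      = contradiction uw irrefl
    ... | no _     | yes _  = refl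
    ... | no _     | no w≢w = contradiction refl w≢w

    at-rest : ∀ a → a ≢ u → a ≢ w → pebble C u w a ≡ C a
    at-rest a a≢u a≢w with a ≟ u | a ≟ w
    ... | yes a≡u | _       = contradiction a≡u a≢u
    ... | no _    | yes a≡w = contradiction a≡w a≢w
    ... | no _    | no _    = refl

  solvable-◅ : ∀ {r C C′} → Move G C C′ → Solvable G r C′ → Solvable G r C
  solvable-◅ mv (D , mvs , 1≤Dr) = D , mv ◅ mvs , 1≤Dr

  module _ (r : Vertex) where

    Fed : (Vertex → ℕ) → Vertex → Set
    Fed f u = f u ≡ 0 ⊎ ∃[ p ] (Adj u p × (p ≡ r ⊎ f u + f u ≤ f p))

    feed : ∀ {f u p b c} → Adj u p → f u ≡ b → f p ≡ c → b + b ≤ c → Fed f u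
    feed {p = p} adj refl refl 2b≤c = inj₂ (p , adj , inj₂ 2b≤c)

    Valid : (Vertex → ℕ) → Set
    Valid f = ∀ u → Fed f u

    -- A sum of valid functions need not be valid, since the summands may feed one vertex towards
    -- different neighbours. Keeping them apart lets each be bounded alone before the bounds are
    -- added.
    data Strategy : (Vertex → ℕ) → Set where
      valid : ∀ {f} → Valid f → Strategy f
      _⊕_   : ∀ {f g} → Strategy f → Strategy g → Strategy (λ a → f a + g a)

    -- Induction on a bound for the size, as each move costs one pebble. If no vertex has
    -- `f a * C a > f a`, the bound holds term by term. Otherwise such a vertex has two pebbles and
    -- positive weight, and moving them to its neighbour `p` either hits the root or keeps the
    -- weighted sum from dropping.
    valid-bound : ∀ {f} → Valid f → ∀ n C → size G C ≤ n →
                  Solvable G r C ⊎ weighted f C ≤ size G f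
    valid-bound {f} f-valid n C |C|≤n with All.all? (λ a → f a * C a ≤? f a) vertices
    ... | yes fC≤f = inj₂ (sum-map-mono fC≤f)
    ... | no fC≰f  with find (¬All⇒Any¬ (λ a → f a * C a ≤? f a) vertices fC≰f)
    ... | u , _ , heavy with f-valid u
    ...   | inj₁ fu≡0 = contradiction (subst (λ c → c * C u ≤ c) (sym fu≡0) z≤n) heavy
    ...   | inj₂ (p , up , p-weight) = reach n |C|≤n p-weight
      where
      2≤Cu : 2 ≤ C u
      2≤Cu = ≰⇒> λ Cu≤1 → heavy (≤-trans (*-monoʳ-≤ (f u) Cu≤1) (≤-reflexive (*-identityʳ (f u))))
      C′ = pebble C u p
      mv = pebble-move C up 2≤Cu
      fC≤fC′ : f u + f u ≤ f p → weighted f C ≤ weighted f C′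
      fC≤fC′ 2fu≤fp = +-cancelʳ-≤ (f u + f u) _ _ (≤-trans (+-monoʳ-≤ (weighted f C) 2fu≤fp)
                        (≤-reflexive (sym (move-weighted f mv))))
      reach : ∀ n → size G C ≤ n → p ≡ r ⊎ f u + f u ≤ f p →
              Solvable G r C ⊎ weighted f C ≤ size G f
      reach n |C|≤n (inj₁ refl) =
        inj₁ (C′ , mv ◅ ε , subst (_≥ 1) (sym (Move.at-w mv)) (s≤s z≤n))
      -- `move-size` turns the bound into `suc (size G C′) ≤ n`, so `n` is a successor and the
      -- recursion runs on its predecessor.
      reach n |C|≤n (inj₂ 2fu≤fp) with n | subst (_≤ n) (move-size mv) |C|≤n
      ... | suc n′ | s≤s |C′|≤n′ =
        Sum.map (solvable-◅ mv) (≤-trans (fC≤fC′ 2fu≤fp)) (valid-bound f-valid n′ C′ |C′|≤n′)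

    strategy-bound : ∀ {f} → Strategy f → ∀ C → Solvable G r C ⊎ weighted f C ≤ size G f
    strategy-bound (valid f-valid) C = valid-bound f-valid (size G C) C ≤-refl
    strategy-bound (_⊕_ {f} {g} F H) C with strategy-bound F C | strategy-bound H C
    ... | inj₁ s    | _         = inj₁ s
    ... | inj₂ _    | inj₁ s    = inj₁ s
    ... | inj₂ fC≤f | inj₂ gC≤g = inj₂ (begin
      weighted (λ a → f a + g a) C     ≡⟨ size-cong (λ a → *-distribʳ-+ (C a) (f a) (g a)) ⟩
      size G (λ a → f a * C a + g a * C a) ≡⟨ sum-map-+ _ _ vertices ⟩
      weighted f C + weighted g C      ≤⟨ +-mono-≤ fC≤f gC≤g ⟩
      size G f + size G g              ≡⟨ sum-map-+ f g vertices ⟨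
      size G (λ a → f a + g a)         ∎)
      where open ≤-Reasoning

    record Certificate (t : ℕ) : Set where
      field
        weight   : Vertex → ℕ
        strategy : Strategy weight
        scale    : ℕ
        covers   : ∀ u → u ≢ r → scale ≤ weight u
        total    : size G weight < scale * t

    -- A pebble on `r` needs no moves. If `C r` is zero, the weight at `r` contributes nothing, so
    -- `covers` off the root already gives `scale * size G C ≤ weighted weight C`; an unsolvable `C`
    -- would then contradict `total`.
    certificate-solves : ∀ {t} → Certificate t → ∀ C → size G C ≡ t → Solvable G r C
    certificate-solves cert C refl with strategy-bound (Certificate.strategy cert) C | C r in Cr
    ... | inj₁ s      | _     = s
    ... | inj₂ _      | suc n = C , ε , subst (_≥ 1) (sym Cr) (s≤s z≤n)
    ... | inj₂ bounded | zero  = contradiction (<-≤-trans total scale*C≤) (<-irrefl refl)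
      where
      open Certificate cert
      scaled : ∀ a → scale * C a ≤ weight a * C a
      scaled a with a ≟ r
      ... | yes refl = subst (λ c → scale * c ≤ weight a * c) (sym Cr) (≤-reflexive (trans
        (*-zeroʳ scale) (sym (*-zeroʳ (weight a)))))
      ... | no a≢r   = *-monoˡ-≤ (C a) (covers a a≢r)
      scale*C≤ : scale * size G C ≤ size G weight
      scale*C≤ = begin
        scale * size G C              ≡⟨ sum-map-* scale C vertices ⟨
        size G (λ a → scale * C a)    ≤⟨ size-mono scaled ⟩
        weighted weight C             ≤⟨ bounded ⟩
        size G weight                 ∎
        where open ≤-Reasoning

  -- Transport of certificates along automorphisms

  record Symmetry : Set where
    field
      to from    : Vertex → Vertex
      to∘from    : ∀ a → to (from a) ≡ a
      from∘to    : ∀ a → from (to a) ≡ a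
      from-Adj   : ∀ {a b} → Adj a b → Adj (from a) (from b)

  module _ (σ : Symmetry) where
    open Symmetry σ

    -- `map to vertices` and `vertices` are duplicate-free with the same members, hence permutations
    -- of each other.
    size-∘ : ∀ f → size G (f ∘ to) ≡ size G f
    size-∘ f = trans (cong sum (map-∘ {g = f} {f = to} vertices))
      (sum-↭ (map⁺ f (∼bag⇒↭ (unique∧set⇒bag (Unique.map⁺ to-injective unique) unique
        (mk⇔ (λ _ → complete _) (λ _ → subst (_∈ map to vertices) (to∘from _) (∈-map⁺ to (complete _))))))))
      where
      to-injective : ∀ {a b} → to a ≡ to b → a ≡ b
      to-injective {a} {b} eq = trans (sym (from∘to a)) (trans (cong from eq) (from∘to b))

    -- Functions are pulled back along `to`, so the root and the feeding neighbours move by `from`;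
    -- that is the direction in which a symmetry carries adjacency.
    valid-∘ : ∀ {r f} → Valid r f → Valid (from r) (f ∘ to)
    valid-∘ {r} {f} f-valid a with f-valid (to a)
    ... | inj₁ f≡0                    = inj₁ f≡0
    ... | inj₂ (p , adj , inj₁ refl)  =
      inj₂ (from p , subst (λ b → Adj b (from p)) (from∘to a) (from-Adj adj) , inj₁ refl)
    ... | inj₂ (p , adj , inj₂ 2f≤fp) =
      inj₂ (from p , subst (λ b → Adj b (from p)) (from∘to a) (from-Adj adj) ,
            inj₂ (subst (λ b → f (to a) + f (to a) ≤ f b) (sym (to∘from p)) 2f≤fp))

    strategy-∘ : ∀ {r f} → Strategy r f → Strategy (from r) (f ∘ to)
    strategy-∘ (valid f-valid) = valid (valid-∘ f-valid)
    strategy-∘ (F ⊕ H)         = strategy-∘ F ⊕ strategy-∘ H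

    certificate-∘ : ∀ {r t} → Certificate r t → Certificate (from r) t
    certificate-∘ {r} {t} cert = record
      { weight   = weight ∘ to
      ; strategy = strategy-∘ strategy
      ; scale    = scale
      ; covers   = λ u u≢ → covers (to u) (λ eq → u≢ (trans (sym (from∘to u)) (cong from eq)))
      ; total    = subst (_< scale * t) (sym (size-∘ weight)) total
      }
      where open Certificate cert

  -- Decidability of solvability and existence of the pebbling number

  Solvable-resp : ∀ {r C C′} → C ≗ C′ → Solvable G r C → Solvable G r C′
  Solvable-resp {C′ = C′} C≗C′ (D , ε , 1≤Dr) = C′ , ε , subst (_≥ 1) (C≗C′ _) 1≤Dr
  Solvable-resp C≗C′ (D , mv ◅ mvs , 1≤Dr) = D , (record
    { u = u ; w = w ; adjacent = adjacent
    ; at-u = trans (sym (C≗C′ u)) at-u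
    ; at-w = trans at-w (cong suc (C≗C′ w))
    ; at-rest = λ a a≢u a≢w → trans (at-rest a a≢u a≢w) (C≗C′ a) }) ◅ mvs , 1≤Dr
    where open Move mv

  ∃? : {P : Vertex → Set} → U.Decidable P → Dec (∃[ a ] P a)
  ∃? P? = map′ (λ x → let a , _ , Pa = find x in a , Pa) (λ (a , Pa) → lose (complete a) Pa)
               (any? P? vertices)

  ≤-size : ∀ C a → C a ≤ size G C
  ≤-size C a = subst (_≤ size G C) (size-δ C a) (size-mono λ b → *-δ-≤ b)
    where
    *-δ-≤ : ∀ b → C b * δ a b ≤ C b
    *-δ-≤ b with a ≟ b
    ... | yes _ = ≤-reflexive (*-identityʳ (C b))
    ... | no _  = ≤-trans (≤-reflexive (*-zeroʳ (C b))) z≤n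

  add : Vertex → Configuration G → Configuration G
  add a C b = C b + δ a b

  size-add : ∀ a C → size G (add a C) ≡ suc (size G C)
  size-add a C = begin
    size G (add a C)                          ≡⟨ sum-map-+ C (δ a) vertices ⟩
    size G C + size G (δ a)                   ≡⟨ cong (size G C +_) (weighted-1 (δ a)) ⟨
    size G C + weighted (λ _ → 1) (δ a)       ≡⟨ cong (size G C +_) (size-δ (λ _ → 1) a) ⟩
    size G C + 1                              ≡⟨ +-comm (size G C) 1 ⟩
    suc (size G C)                            ∎
    where open ≡-Reasoning

  remove : ∀ {n} C → size G C ≡ suc n → ∃[ a ] ∃[ C′ ] (size G C′ ≡ n × add a C′ ≗ C)
  remove {n} C |C|≡ with ∃? (λ a → 1 ≤? C a)
  ... | no none = contradiction (trans (sym |C|≡) (n≤0⇒n≡0 |C|≤0)) λ ()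
    where
    |C|≤0 : size G C ≤ 0
    |C|≤0 = ≤-trans (size-mono {C′ = λ _ → 0} λ a → ≮⇒≥ λ 1≤Ca → none (a , 1≤Ca))
                    (≤-reflexive (sum-map-* 0 (λ _ → 0) vertices))
  ... | yes (a , 1≤Ca) = a , C′ , suc-injective |C′|≡ , restore
    where
    C′ : Configuration G
    C′ b = C b ∸ δ a b
    δ≤C : ∀ b → δ a b ≤ C b
    δ≤C b with a ≟ b
    ... | yes refl = 1≤Ca
    ... | no _     = z≤n
    restore : add a C′ ≗ C
    restore b = m∸n+n≡m (δ≤C b)
    |C′|≡ : suc (size G C′) ≡ suc n
    |C′|≡ = trans (sym (size-add a C′)) (trans (size-cong restore) |C|≡)

  ∀? : {P : Vertex → Set} → U.Decidable P → Dec (∀ a → P a)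
  ∀? P? = map′ (λ Ps a → All.lookup Ps (complete a)) (λ Ps → All.universal Ps vertices)
               (All.all? P? vertices)

  module _ (P : Configuration G → Set) (P? : U.Decidable P)
           (P-resp : ∀ {C C′} → C ≗ C′ → P C → P C′) where

    -- A configuration of size n arises from the empty one by adding n single
    -- pebbles; C₀ collects those added so far.
    ofSize? : ∀ n C₀ → Dec (∀ C → size G C ≡ n → P (λ a → C a + C₀ a))
    ofSize? zero C₀ = map′
      (λ P₀ C |C|≡0 → P-resp
        (λ a → cong (_+ C₀ a) (sym (n≤0⇒n≡0 (subst (C a ≤_) |C|≡0 (≤-size C a))))) P₀)
      (λ Ps → Ps (λ _ → 0) (sum-map-* 0 (λ _ → 0) vertices))
      (P? C₀)
    ofSize? (suc n) C₀ = map′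
      (λ Ps C |C|≡ → let a , C′ , |C′|≡ , C′+a≗C = remove C |C|≡ in
         P-resp (λ b → trans (sym (+-assoc (C′ b) (δ a b) (C₀ b))) (cong (_+ C₀ b) (C′+a≗C b)))
                (Ps a C′ |C′|≡))
      (λ Ps a C |C|≡ → P-resp (λ b → +-assoc (C b) (δ a b) (C₀ b))
                              (Ps (add a C) (trans (size-add a C) (cong suc |C|≡))))
      (∀? λ a → ofSize? n (λ b → δ a b + C₀ b))

  module _ (_∼?_ : Decidable Adj) where

    FirstMove : Vertex → Configuration G → Set
    FirstMove r C = ∃[ u ] ∃[ w ] (Adj u w × 2 ≤ C u × Solvable G r (pebble C u w))

    -- An arbitrary move agrees pointwise with an explicit `pebble C u w`, so a search over pairs of
    -- vertices misses nothing. Configurations are functions, hence the appeal to `Solvable-resp` in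
    -- place of equality.
    firstMove : ∀ {r C} → Solvable G r C → C r ≥ 1 ⊎ FirstMove r C
    firstMove (_ , ε , 1≤Cr) = inj₁ 1≤Cr
    firstMove {C = C} (D , _◅_ {j = C′} mv mvs , 1≤Dr) =
      inj₂ (u , w , adjacent , 2≤Cu , Solvable-resp same (D , mvs , 1≤Dr))
      where
      open Move mv
      2≤Cu : 2 ≤ C u
      2≤Cu = subst (2 ≤_) (sym at-u) (m≤m+n 2 (C′ u))
      same : C′ ≗ pebble C u w
      same a = +-cancelʳ-≡ (δ u a + δ u a) _ _
        (trans (move-balance mv a) (sym (move-balance (pebble-move C adjacent 2≤Cu) a)))

    -- Exhaustive search over first moves. The bound `n` on the size falls with every move, which
    -- makes the mutual recursion terminate.
    solvable? : ∀ r n C → size G C ≤ n → Dec (Solvable G r C)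
    firstMove? : ∀ r n C → size G C ≤ n → Dec (FirstMove r C)

    solvable? r n C |C|≤n =
      map′ Sum.[ (λ 1≤Cr → C , ε , 1≤Cr)
               , (λ (u , w , uw , 2≤Cu , s) → solvable-◅ (pebble-move C uw 2≤Cu) s) ]
           firstMove
           ((1 ≤? C r) ⊎-dec firstMove? r n C |C|≤n)

    firstMove? r n C |C|≤n = ∃? λ u → ∃? λ w → attempt u w n |C|≤n
      where
      attempt : ∀ u w n → size G C ≤ n → Dec (Adj u w × 2 ≤ C u × Solvable G r (pebble C u w))
      attempt u w n |C|≤n with u ∼? w | 2 ≤? C u
      ... | no ¬uw | _        = no (¬uw ∘ proj₁)
      ... | yes _  | no 2≰Cu  = no (2≰Cu ∘ proj₁ ∘ proj₂)
      ... | yes uw | yes 2≤Cu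
        with n | subst (_≤ n) (move-size (pebble-move C uw 2≤Cu)) |C|≤n
      ...   | suc n′ | s≤s |C′|≤n′ =
        map′ (λ s → uw , 2≤Cu , s) (proj₂ ∘ proj₂) (solvable? r n′ (pebble C u w) |C′|≤n′)

    allSolvable? : U.Decidable (AllSolvable G)
    allSolvable? t = ∀? λ r → map′
      -- The enumeration starts from the empty configuration, so it speaks of `C a + 0`, which
      -- agrees with `C a` only pointwise.
      (λ Ps C |C|≡ → Solvable-resp (λ a → +-identityʳ (C a)) (Ps C |C|≡))
      (λ Ps C |C|≡ → Solvable-resp (λ a → sym (+-identityʳ (C a))) (Ps C |C|≡))
      (ofSize? (Solvable G r) (λ C → solvable? r (size G C) C ≤-refl) Solvable-resp t (λ _ → 0))

    pebblingNumber≤ : ∀ {t} → (∀ r → Certificate r t) → ∃[ p ] (IsPebblingNumber G p × p ≤ t)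
    pebblingNumber≤ {t} cert with least allSolvable? t (λ r → certificate-solves r (cert r))
    ... | p , solves , minimum , p≤t = p , record { allSolvable = solves ; minimum = minimum } , p≤t

-- Decidable equality and adjacency in the flower graph

module _ {m : ℕ} where

  _≟_ᶠ : DecidableEquality (FlowerVertex m)
  v i ≟ v j ᶠ = map′ (cong v) (λ { refl → refl }) (i Fin.≟ j)
  x i ≟ x j ᶠ = map′ (cong x) (λ { refl → refl }) (i Fin.≟ j)
  y i ≟ y j ᶠ = map′ (cong y) (λ { refl → refl }) (i Fin.≟ j)
  z i ≟ z j ᶠ = map′ (cong z) (λ { refl → refl }) (i Fin.≟ j)
  v _ ≟ x _ ᶠ = no λ ()
  v _ ≟ y _ ᶠ = no λ ()
  v _ ≟ z _ ᶠ = no λ ()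
  x _ ≟ v _ ᶠ = no λ ()
  x _ ≟ y _ ᶠ = no λ ()
  x _ ≟ z _ ᶠ = no λ ()
  y _ ≟ v _ ᶠ = no λ ()
  y _ ≟ x _ ᶠ = no λ ()
  y _ ≟ z _ ᶠ = no λ ()
  z _ ≟ v _ ᶠ = no λ ()
  z _ ≟ x _ ᶠ = no λ ()
  z _ ≟ y _ ᶠ = no λ ()

  next? : (i j : Fin m) → Dec (Next i j)
  next? i j = toℕ j ≟ suc (toℕ i)

  close? : (i j : Fin m) → Dec (Last i × First j)
  close? i j = (suc (toℕ i) ≟ m) ×-dec (toℕ j ≟ 0)

  flowerEdge? : Decidable (FlowerEdge {m})
  flowerEdge? (v i) (v j) = map′
    (λ { (inj₁ n) → vv n ; (inj₂ (l , f)) → vv-close l f })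
    (λ { (vv n) → inj₁ n ; (vv-close l f) → inj₂ (l , f) })
    (next? i j ⊎-dec close? i j)
  flowerEdge? (x i) (x j) = map′ xx (λ { (xx n) → n }) (next? i j)
  flowerEdge? (y i) (y j) = map′ yy (λ { (yy n) → n }) (next? i j)
  flowerEdge? (x i) (y j) =
    map′ (λ { (l , f) → xy-close l f }) (λ { (xy-close l f) → l , f }) (close? i j)
  flowerEdge? (y i) (x j) =
    map′ (λ { (l , f) → yx-close l f }) (λ { (yx-close l f) → l , f }) (close? i j)
  flowerEdge? (z i) (v j) = map′ (λ { refl → zv i }) (λ { (zv _) → refl }) (i Fin.≟ j)
  flowerEdge? (z i) (x j) = map′ (λ { refl → zx i }) (λ { (zx _) → refl }) (i Fin.≟ j)
  flowerEdge? (z i) (y j) = map′ (λ { refl → zy i }) (λ { (zy _) → refl }) (i Fin.≟ j)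
  flowerEdge? (v _) (x _) = no λ ()
  flowerEdge? (v _) (y _) = no λ ()
  flowerEdge? (x _) (v _) = no λ ()
  flowerEdge? (y _) (v _) = no λ ()
  flowerEdge? (v _) (z _) = no λ ()
  flowerEdge? (x _) (z _) = no λ ()
  flowerEdge? (y _) (z _) = no λ ()
  flowerEdge? (z _) (z _) = no λ ()

  adj? : Decidable (Graph.Adj (J m))
  adj? u w = ¬? (u ≟ w ᶠ) ×-dec (flowerEdge? u w ⊎-dec flowerEdge? w u)

  edge-≢ : ∀ {u w} → 2 ≤ m → FlowerEdge {m} u w → u ≢ w
  edge-≢ _   (vv n)         refl = 1+n≢n (sym n)
  edge-≢ _   (xx n)         refl = 1+n≢n (sym n)
  edge-≢ _   (yy n)         refl = 1+n≢n (sym n)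
  -- A loop here would have an index both first and last, forcing `m` to be 1.
  edge-≢ 2≤m (vv-close l f) refl = <⇒≢ 2≤m (trans (cong suc (sym f)) l)

  edge⇒adj : ∀ {u w} → 2 ≤ m → FlowerEdge {m} u w → Graph.Adj (J m) u w
  edge⇒adj 2≤m e = edge-≢ 2≤m e , inj₁ e

-- The three lines and the rotation of the flower graph

data Line : Set where
  V X Y : Line

_≟ˡ_ : DecidableEquality Line
V ≟ˡ V = yes refl
X ≟ˡ X = yes refl
Y ≟ˡ Y = yes refl
V ≟ˡ X = no λ ()
V ≟ˡ Y = no λ ()
X ≟ˡ V = no λ ()
X ≟ˡ Y = no λ ()
Y ≟ˡ V = no λ ()
Y ≟ˡ X = no λ ()

-- The twist of the closing edges: going once around fixes the cycle of the `v` and exchanges the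
-- `x` and `y`.
cross : Line → Line
cross V = V
cross X = Y
cross Y = X

line : ∀ {m} → Line → Fin m → FlowerVertex m
line V = v
line X = x
line Y = y

index : ∀ {m} → FlowerVertex m → Fin m
index (v i) = i
index (x i) = i
index (y i) = i
index (z i) = i

-- Matching on `row u` merges the constructors `v`, `x`, `y` into the single case `line ℓ i`, so
-- that arguments can be uniform in the line.
data Row {m} : FlowerVertex m → Set where
  onLine : ∀ ℓ i → Row (line ℓ i)
  onZ    : ∀ i → Row (z i)

row : ∀ {m} (u : FlowerVertex m) → Row u
row (v i) = onLine V i
row (x i) = onLine X i
row (y i) = onLine Y i
row (z i) = onZ i

next-edge : ∀ {m} ℓ {i j : Fin m} → Next i j → FlowerEdge (line ℓ i) (line ℓ j)
next-edge V = vv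
next-edge X = xx
next-edge Y = yy

close-edge : ∀ {m} ℓ {i j : Fin m} → Last i → First j → FlowerEdge (line ℓ i) (line (cross ℓ) j)
close-edge V = vv-close
close-edge X = xy-close
close-edge Y = yx-close

z-edge : ∀ {m} ℓ (i : Fin m) → FlowerEdge (z i) (line ℓ i)
z-edge V = zv
z-edge X = zx
z-edge Y = zy

cross-involutive : ∀ ℓ → cross (cross ℓ) ≡ ℓ
cross-involutive V = refl
cross-involutive X = refl
cross-involutive Y = refl

lastOrNot : ∀ {n} (i : Fin (suc n)) → i ≡ fromℕ n ⊎ ∃[ j ] i ≡ inject₁ j
lastOrNot i with view i
... | ‵fromℕ     = inj₁ refl
... | ‵inject₁ j = inj₂ (j , refl)

module Rotation (n : ℕ) where

  private
    m : ℕ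
    m = suc (suc n)

  -- Rotation by one index, with `x` and `y` exchanged at the wrap-around. Under the inverse
  -- `forth`, line edges into the last index become closing edges, and closing edges become ordinary
  -- edges from index 0 to 1.
  back : FlowerVertex m → FlowerVertex m
  back (z zero)    = z (fromℕ (suc n))
  back (z (suc i)) = z (inject₁ i)
  back (v zero)    = v (fromℕ (suc n))
  back (v (suc i)) = v (inject₁ i)
  back (x zero)    = y (fromℕ (suc n))
  back (x (suc i)) = x (inject₁ i)
  back (y zero)    = x (fromℕ (suc n))
  back (y (suc i)) = y (inject₁ i)

  forth : FlowerVertex m → FlowerVertex m
  forth (z i) with view i
  ... | ‵fromℕ     = z zero
  ... | ‵inject₁ j = z (suc j)
  forth (v i) with view i
  ... | ‵fromℕ     = v zero
  ... | ‵inject₁ j = v (suc j)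
  forth (x i) with view i
  ... | ‵fromℕ     = y zero
  ... | ‵inject₁ j = x (suc j)
  forth (y i) with view i
  ... | ‵fromℕ     = x zero
  ... | ‵inject₁ j = y (suc j)

  forth-line-last : ∀ ℓ → forth (line ℓ (fromℕ (suc n))) ≡ line (cross ℓ) zero
  forth-line-last V rewrite view-fromℕ n = refl
  forth-line-last X rewrite view-fromℕ n = refl
  forth-line-last Y rewrite view-fromℕ n = refl

  forth-line : ∀ ℓ j → forth (line ℓ (inject₁ j)) ≡ line ℓ (suc j)
  forth-line V j rewrite view-inject₁ j = refl
  forth-line X j rewrite view-inject₁ j = refl
  forth-line Y j rewrite view-inject₁ j = refl

  forth-z-last : forth (z (fromℕ (suc n))) ≡ z zero
  forth-z-last rewrite view-fromℕ n = refl

  forth-z : ∀ j → forth (z (inject₁ j)) ≡ z (suc j)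
  forth-z j rewrite view-inject₁ j = refl

  back-line : ∀ ℓ j → back (line ℓ (suc j)) ≡ line ℓ (inject₁ j)
  back-line V j = refl
  back-line X j = refl
  back-line Y j = refl

  back-line-zero : ∀ ℓ → back (line (cross ℓ) zero) ≡ line ℓ (fromℕ (suc n))
  back-line-zero V = refl
  back-line-zero X = refl
  back-line-zero Y = refl

  back∘forth : ∀ u → back (forth u) ≡ u
  back∘forth u with row u
  ... | onLine ℓ i with lastOrNot i
  ...   | inj₁ refl       = trans (cong back (forth-line-last ℓ)) (back-line-zero ℓ)
  ...   | inj₂ (j , refl) = trans (cong back (forth-line ℓ j)) (back-line ℓ j)
  back∘forth _ | onZ i with lastOrNot i
  ...   | inj₁ refl       = cong back forth-z-last
  ...   | inj₂ (j , refl) = cong back (forth-z j)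

  forth∘back : ∀ (u : FlowerVertex m) → forth (back u) ≡ u
  forth∘back (z zero)    = forth-z-last
  forth∘back (z (suc i)) = forth-z i
  forth∘back (v zero)    = forth-line-last V
  forth∘back (v (suc i)) = forth-line V i
  forth∘back (x zero)    = forth-line-last Y
  forth∘back (x (suc i)) = forth-line X i
  forth∘back (y zero)    = forth-line-last X
  forth∘back (y (suc i)) = forth-line Y i

  forth-next : ∀ ℓ {i j : Fin m} → Next i j → FlowerEdge (forth (line ℓ i)) (forth (line ℓ j))
  forth-next ℓ {i} {j} nx with lastOrNot i
  -- Nothing follows the last index.
  ... | inj₁ refl = contradiction (trans nx (cong suc (toℕ-fromℕ (suc n)))) (<⇒≢ (toℕ<n j))
  ... | inj₂ (i′ , refl) with lastOrNot j
  ...   | inj₁ refl = subst₂ FlowerEdge (sym (forth-line ℓ i′)) (sym (forth-line-last ℓ))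
          (close-edge ℓ (cong suc (sym j≡)) refl)
    where
    j≡ : suc n ≡ suc (toℕ i′)
    j≡ = trans (sym (toℕ-fromℕ (suc n))) (trans nx (cong suc (toℕ-inject₁ i′)))
  ...   | inj₂ (j′ , refl) = subst₂ FlowerEdge (sym (forth-line ℓ i′)) (sym (forth-line ℓ j′))
          (next-edge ℓ (cong suc (trans (sym (toℕ-inject₁ j′)) (trans nx (cong suc (toℕ-inject₁ i′))))))

  forth-close : ∀ ℓ {i j : Fin m} → Last i → First j →
                FlowerEdge (forth (line ℓ i)) (forth (line (cross ℓ) j))
  forth-close ℓ {i} {j} l f
    with toℕ-injective {i = i} {j = fromℕ (suc n)} (suc-injective (trans l (cong suc (sym (toℕ-fromℕ (suc n))))))
       | toℕ-injective {i = j} {j = zero} f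
  ... | refl | refl = subst₂ FlowerEdge (sym (forth-line-last ℓ)) (sym (forth-line (cross ℓ) zero))
                        (next-edge (cross ℓ) refl)

  forth-spoke : ∀ ℓ i → FlowerEdge (forth (z i)) (forth (line ℓ i))
  forth-spoke ℓ i with lastOrNot i
  ... | inj₁ refl       =
    subst₂ FlowerEdge (sym forth-z-last) (sym (forth-line-last ℓ)) (z-edge (cross ℓ) zero)
  ... | inj₂ (j , refl) =
    subst₂ FlowerEdge (sym (forth-z j)) (sym (forth-line ℓ j)) (z-edge ℓ (suc j))

  forth-edge : ∀ {u w} → FlowerEdge u w → FlowerEdge (forth u) (forth w)
  forth-edge (zv i)         = forth-spoke V i
  forth-edge (zx i)         = forth-spoke X i
  forth-edge (zy i)         = forth-spoke Y i
  forth-edge (vv nx)        = forth-next V nx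
  forth-edge (xx nx)        = forth-next X nx
  forth-edge (yy nx)        = forth-next Y nx
  forth-edge (vv-close l f) = forth-close V l f
  forth-edge (xy-close l f) = forth-close X l f
  forth-edge (yx-close l f) = forth-close Y l f

  open Pebbling (J m) _≟_ᶠ

  rotation : Symmetry
  rotation = record
    { to = back ; from = forth ; to∘from = back∘forth ; from∘to = forth∘back
    ; from-Adj = λ (u≢w , e) →
        (λ eq → u≢w (trans (sym (back∘forth _)) (trans (cong back eq) (back∘forth _)))) ,
        Sum.map forth-edge forth-edge e
    }

  index-back : ∀ u {i} → toℕ (index u) ≡ suc i → toℕ (index (back u)) ≡ i
  index-back (v (suc i)) eq = trans (toℕ-inject₁ i) (suc-injective eq)
  index-back (x (suc i)) eq = trans (toℕ-inject₁ i) (suc-injective eq)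
  index-back (y (suc i)) eq = trans (toℕ-inject₁ i) (suc-injective eq)
  index-back (z (suc i)) eq = trans (toℕ-inject₁ i) (suc-injective eq)

  index-back-0 : ∀ u → toℕ (index u) ≡ 0 → toℕ (index (back u)) ≡ suc n
  index-back-0 (v zero) _ = toℕ-fromℕ (suc n)
  index-back-0 (x zero) _ = toℕ-fromℕ (suc n)
  index-back-0 (y zero) _ = toℕ-fromℕ (suc n)
  index-back-0 (z zero) _ = toℕ-fromℕ (suc n)

  module _ {t : ℕ} where

    CertificatesAt : ℕ → Set
    CertificatesAt i = ∀ u → toℕ (index u) ≡ i → Certificate u t

    rotated : ∀ {u} → Certificate (back u) t → Certificate u t
    rotated {u} c = subst (λ w → Certificate w t) (forth∘back u) (certificate-∘ rotation c)

    at-suc : ∀ {i} → CertificatesAt i → CertificatesAt (suc i)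
    at-suc cs u eq = rotated (cs (back u) (index-back u eq))

    at-zero : CertificatesAt (suc n) → CertificatesAt 0
    at-zero cs u eq = rotated (cs (back u) (index-back-0 u eq))

    at-+ : ∀ {i} d → CertificatesAt i → CertificatesAt (d + i)
    at-+ zero    cs = cs
    at-+ (suc d) cs = at-suc (at-+ d cs)

    -- The rotation only raises the index, so certificates travel from `i` up to the last index,
    -- around to 0, and from there up to the index of `u`.
    at-all : ∀ {i} → i ≤ suc n → CertificatesAt i → ∀ u → Certificate u t
    at-all {i} i≤ cs u = subst CertificatesAt (+-identityʳ (toℕ (index u)))
      (at-+ (toℕ (index u)) (at-zero (subst CertificatesAt (m∸n+n≡m i≤) (at-+ (suc n ∸ i) cs)))) u refl

-- Sums over initial segments of the naturals

Σ< : ℕ → (ℕ → ℕ) → ℕ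
Σ< n f = sum (applyUpTo f n)

Σ<-cong : ∀ n {f g : ℕ → ℕ} → (∀ i → i < n → f i ≡ g i) → Σ< n f ≡ Σ< n g
Σ<-cong zero    f≡g = refl
Σ<-cong (suc n) f≡g = cong₂ _+_ (f≡g 0 z<s) (Σ<-cong n λ i i<n → f≡g (suc i) (s<s i<n))

Σ<-+ : ∀ m n f → Σ< (m + n) f ≡ Σ< m f + Σ< n (λ i → f (m + i))
Σ<-+ zero    n f = refl
Σ<-+ (suc m) n f = trans (cong (f 0 +_) (Σ<-+ m n (f ∘ suc))) (sym (+-assoc (f 0) _ _))

Σ<-* : ∀ n c f → Σ< n (λ i → c * f i) ≡ c * Σ< n f
Σ<-* zero    c f = sym (*-zeroʳ c)
Σ<-* (suc n) c f = trans (cong (c * f 0 +_) (Σ<-* n c (f ∘ suc))) (sym (*-distribˡ-+ c (f 0) _))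

Σ<-const : ∀ n c → Σ< n (λ _ → c) ≡ n * c
Σ<-const zero    c = refl
Σ<-const (suc n) c = cong (c +_) (Σ<-const n c)

-- The geometric sum without subtraction. Writing `2 ^ k` as the successor of this sum later makes
-- all total weights polynomial in the sum and `k`, within reach of the ring solver.
Σ<-2^ : ∀ n → suc (Σ< n (2 ^_)) ≡ 2 ^ n
Σ<-2^ zero    = refl
Σ<-2^ (suc n) = begin
  2 + Σ< n (λ i → 2 * 2 ^ i) ≡⟨ cong (2 +_) (Σ<-* n 2 (2 ^_)) ⟩
  2 + 2 * Σ< n (2 ^_)        ≡⟨ *-suc 2 (Σ< n (2 ^_)) ⟨
  2 * suc (Σ< n (2 ^_))      ≡⟨ cong (2 *_) (Σ<-2^ n) ⟩
  2 * 2 ^ n                  ∎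
  where open ≡-Reasoning

-- Needed on the right side, where the distance to the end falls as the index grows.
Σ<-reverse : ∀ n f → Σ< n (λ i → f (n ∸ suc i)) ≡ Σ< n f
Σ<-reverse n f = begin
  Σ< n (λ i → f (n ∸ suc i))     ≡⟨ cong sum (downFrom n) ⟩
  sum (applyDownFrom f n)        ≡⟨ cong sum (reverse-applyUpTo f n) ⟨
  sum (reverse (applyUpTo f n)) ≡⟨ sum-↭ (↭-reverse (applyUpTo f n)) ⟩
  Σ< n f                         ∎
  where
  open ≡-Reasoning
  downFrom : ∀ n → applyUpTo (λ i → f (n ∸ suc i)) n ≡ applyDownFrom f n
  downFrom zero    = refl
  downFrom (suc n) = cong (f n ∷_) (downFrom n)

sum-tabulate : ∀ n f → sum (tabulate {n = n} (f ∘ toℕ)) ≡ Σ< n f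
sum-tabulate zero    f = refl
sum-tabulate (suc n) f = cong (f 0 +_) (sum-tabulate n (f ∘ suc))

-- An index i ≠ 0 of {−k, …, k} is described by its side and by its distance
-- e < k to the end ±k of that side; e = k would be the centre on both sides.
data Side : Set where
  left right : Side

opp : Side → Side
opp left  = right
opp right = left

on : ∀ {A : Set} → Side → A → A → Side → A
on left  a b left  = a
on left  a b right = b
on right a b left  = b
on right a b right = a

on-same : ∀ {A : Set} s (a b : A) → on s a b s ≡ a
on-same left  a b = refl
on-same right a b = refl

on-opp : ∀ {A : Set} s (a b : A) → on s a b (opp s) ≡ b
on-opp left  a b = refl
on-opp right a b = refl

choose : ∀ {A : Set} → Line → A → A → Line → A
choose a p q ℓ with a ≟ˡ ℓ
... | yes _ = p
... | no  _ = q

-- The values of a function along one of the rows `v`, `x`, `y`, `z`, with `arm s e` at distance `e`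
-- from the end of side `s`. The centre has its own field because it would be `e = k` on both arms.
record Profile : Set where
  field
    arm    : Side → ℕ → ℕ
    centre : ℕ

open Profile

-- Positions, adjacencies and weights relative to the centre

module Weights (k : ℕ) (2≤k : 2 ≤ k) where

  m : ℕ
  m = suc (k + k)

  open Graph (J m) using (Adj; adj-sym)
  open Pebbling (J m) _≟_ᶠ

  2≤m : 2 ≤ m
  2≤m = ≤-trans 2≤k (≤-trans (m≤m+n k k) (n≤1+n (k + k)))

  mid : Fin m
  mid = fromℕ< (s≤s (m≤m+n k k))

  toℕ-mid : toℕ mid ≡ k
  toℕ-mid = toℕ-fromℕ< (s≤s (m≤m+n k k))

  -- The ends -k and k are the elements 0 and `k + k` of `Fin m`. The distance to the right end is
  -- stated additively to avoid truncated subtraction.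
  At : Side → ℕ → Fin m → Set
  At left  e i = toℕ i ≡ e
  At right e i = toℕ i + e ≡ k + k

  data Position : Fin m → Set where
    at-mid : Position mid
    at-arm : ∀ s {e i} → e < k → At s e i → Position i

  position : ∀ i → Position i
  position i with <-cmp (toℕ i) k
  ... | tri< i<k _ _ = at-arm left i<k refl
  ... | tri≈ _ i≡k _ = subst Position (sym (toℕ-injective (trans i≡k (sym toℕ-mid)))) at-mid
  ... | tri> _ _ k<i = at-arm right
    (+-cancelˡ-< k _ _ (<-≤-trans (+-monoˡ-< (k + k ∸ toℕ i) k<i) (≤-reflexive i+≡)))
    i+≡
    where
    i+≡ : toℕ i + (k + k ∸ toℕ i) ≡ k + k
    i+≡ = m+[n∸m]≡n (s≤s⁻¹ (toℕ<n i))

  -- One step towards the centre. The new distance may be `k` itself, in which case `at-k`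
  -- identifies the vertex as central from either side.
  inner : ∀ s {e i} → e < k → At s e i →
          ∃[ j ] (At s (suc e) j × ∀ ℓ → Adj (line ℓ i) (line ℓ j))
  inner left {e} {i} e<k refl = j , j≡ , λ ℓ → edge⇒adj 2≤m (next-edge ℓ j≡)
    where
    j<m : suc (toℕ i) < m
    j<m = s≤s (≤-trans e<k (m≤m+n k k))
    j = fromℕ< j<m
    j≡ = toℕ-fromℕ< j<m
  inner right {e} {zero} e<k eq = contradiction (≤-trans (m≤m+n k k) (≤-reflexive (sym eq))) (<⇒≱ e<k)
  inner right {e} {suc i} e<k eq = inject₁ i ,
    trans (+-suc (toℕ (inject₁ i)) e) (trans (cong (λ n → suc (n + e)) (toℕ-inject₁ i)) eq) ,
    λ ℓ → adj-sym {u = line ℓ (inject₁ i)} (edge⇒adj 2≤m (next-edge ℓ (cong suc (sym (toℕ-inject₁ i)))))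

  at-k : ∀ s {i} → At s k i → i ≡ mid
  at-k left  eq = toℕ-injective (trans eq (sym toℕ-mid))
  at-k right {i} eq = toℕ-injective (trans (+-cancelʳ-≡ k (toℕ i) k eq) (sym toℕ-mid))

  across : ∀ s {i} → At s 0 i →
           ∃[ j ] (At (opp s) 0 j × ∀ ℓ → Adj (line ℓ i) (line (cross ℓ) j))
  across left {i} eq = fromℕ (k + k) , trans (+-identityʳ _) (toℕ-fromℕ (k + k)) ,
    λ ℓ → adj-sym {u = line (cross ℓ) (fromℕ (k + k))} (edge⇒adj 2≤m
      -- From the left end the closing edge is traversed backwards, from line `cross ℓ` to
      -- `cross (cross ℓ)`, which is `ℓ`.
      (subst (λ ℓ′ → FlowerEdge (line (cross ℓ) (fromℕ (k + k))) (line ℓ′ i)) (cross-involutive ℓ)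
        (close-edge (cross ℓ) (cong suc (toℕ-fromℕ (k + k))) eq)))
  across right {i} eq = zero , refl ,
    λ ℓ → edge⇒adj 2≤m (close-edge ℓ (cong suc (trans (sym (+-identityʳ (toℕ i))) eq)) refl)

  value : Profile → ℕ → ℕ
  value p i with <-cmp i k
  ... | tri< _ _ _ = arm p left i
  ... | tri≈ _ _ _ = centre p
  ... | tri> _ _ _ = arm p right (k + k ∸ i)

  value-left : ∀ p {i} → i < k → value p i ≡ arm p left i
  value-left p {i} i<k with <-cmp i k
  ... | tri< _ _ _   = refl
  ... | tri≈ i≮k _ _ = contradiction i<k i≮k
  ... | tri> i≮k _ _ = contradiction i<k i≮k

  value-centre : ∀ p → value p k ≡ centre p
  value-centre p with <-cmp k k
  ... | tri< _ k≢k _ = contradiction refl k≢k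
  ... | tri≈ _ _ _   = refl
  ... | tri> _ k≢k _ = contradiction refl k≢k

  value-right : ∀ p {i} → k < i → value p i ≡ arm p right (k + k ∸ i)
  value-right p {i} k<i with <-cmp i k
  ... | tri< _ _ k≮i = contradiction k<i k≮i
  ... | tri≈ _ _ k≮i = contradiction k<i k≮i
  ... | tri> _ _ _   = refl

  value-mid : ∀ p → value p (toℕ mid) ≡ centre p
  value-mid p = trans (cong (value p) toℕ-mid) (value-centre p)

  value-at : ∀ p s {e i} → e < k → At s e i → value p (toℕ i) ≡ arm p s e
  value-at p left  e<k refl = value-left p e<k
  value-at p right {e} {i} e<k eq = trans (value-right p k<i) (cong (arm p right) e≡)
    where
    k<i : k < toℕ i
    k<i = +-cancelʳ-< k k (toℕ i) (≤-<-trans (≤-reflexive (sym eq)) (+-monoʳ-< (toℕ i) e<k))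
    e≡ : k + k ∸ toℕ i ≡ e
    e≡ = trans (cong (_∸ toℕ i) (sym eq)) (m+n∸m≡n (toℕ i) e)

  mass : Profile → ℕ
  mass p = Σ< k (arm p left) + (centre p + Σ< k (arm p right))

  sum-value : ∀ p → sum (map (λ i → value p (toℕ i)) (allFin m)) ≡ mass p
  sum-value p = begin
    sum (map (λ i → value p (toℕ i)) (allFin m))
      ≡⟨ cong sum (map-tabulate {n = m} (λ i → i) (λ i → value p (toℕ i))) ⟩
    sum (tabulate {n = m} (value p ∘ toℕ))
      ≡⟨ sum-tabulate m (value p) ⟩
    Σ< m (value p)
      -- The 2k + 1 indices split into k on the left, the centre, and k on the right.
      ≡⟨ cong (λ n → Σ< n (value p)) (+-suc k k) ⟨
    Σ< (k + suc k) (value p)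
      ≡⟨ Σ<-+ k (suc k) (value p) ⟩
    Σ< k (value p) + (value p (k + 0) + Σ< k (λ i → value p (k + suc i)))
      ≡⟨ cong₂ _+_ (Σ<-cong k λ i i<k → value-left p i<k)
           (cong₂ _+_ (trans (cong (value p) (+-identityʳ k)) (value-centre p)) (trans
             (Σ<-cong k λ i i<k → trans (value-right p (m<m+n k z<s))
               (cong (arm p right) ([m+n]∸[m+o]≡n∸o k k (suc i))))
             (Σ<-reverse k (arm p right)))) ⟩
    mass p ∎
    where open ≡-Reasoning

  weight : (Line → Profile) → Profile → FlowerVertex m → ℕ
  weight P Q (v i) = value (P V) (toℕ i)
  weight P Q (x i) = value (P X) (toℕ i)
  weight P Q (y i) = value (P Y) (toℕ i)
  weight P Q (z i) = value Q (toℕ i)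

  weight-line : ∀ P Q ℓ i → weight P Q (line ℓ i) ≡ value (P ℓ) (toℕ i)
  weight-line P Q V i = refl
  weight-line P Q X i = refl
  weight-line P Q Y i = refl

  weight-line-mid : ∀ P Q ℓ → weight P Q (line ℓ mid) ≡ centre (P ℓ)
  weight-line-mid P Q ℓ = trans (weight-line P Q ℓ mid) (value-mid (P ℓ))

  weight-line-at : ∀ P Q ℓ s {e i} → e < k → At s e i → weight P Q (line ℓ i) ≡ arm (P ℓ) s e
  weight-line-at P Q ℓ s e<k at = trans (weight-line P Q ℓ _) (value-at (P ℓ) s e<k at)

  size-weight : ∀ P Q → size (J m) (weight P Q) ≡ mass (P V) + (mass (P X) + (mass (P Y) + mass Q))
  size-weight P Q = begin
    sum (map w (map v F ++ map x F ++ map y F ++ map z F))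
      ≡⟨ split (map v F) _ ⟩
    S v + sum (map w (map x F ++ map y F ++ map z F))
      ≡⟨ cong (S v +_) (split (map x F) _) ⟩
    S v + (S x + sum (map w (map y F ++ map z F)))
      ≡⟨ cong (λ n → S v + (S x + n)) (split (map y F) _) ⟩
    S v + (S x + (S y + S z))
      ≡⟨ cong₂ _+_ (row-sum v (P V) λ _ → refl) (cong₂ _+_ (row-sum x (P X) λ _ → refl)
           (cong₂ _+_ (row-sum y (P Y) λ _ → refl) (row-sum z Q λ _ → refl))) ⟩
    mass (P V) + (mass (P X) + (mass (P Y) + mass Q)) ∎
    where
    open ≡-Reasoning
    w = weight P Q
    F = allFin m
    S : (Fin m → FlowerVertex m) → ℕ
    S c = sum (map w (map c F))
    split : ∀ us us′ → sum (map w (us ++ us′)) ≡ sum (map w us) + sum (map w us′)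
    split us us′ = trans (cong sum (map-++ w us us′)) (sum-++ (map w us) (map w us′))
    row-sum : ∀ (c : Fin m → FlowerVertex m) p → (∀ i → w (c i) ≡ value p (toℕ i)) → S c ≡ mass p
    row-sum c p wc≡ = trans (cong sum (trans (sym (map-∘ {g = w} {f = c} F)) (map-cong wc≡ F)))
                            (sum-value p)

side : ∀ s t → t ≡ s ⊎ t ≡ opp s
side left  left  = inj₁ refl
side left  right = inj₂ refl
side right left  = inj₂ refl
side right right = inj₁ refl

opp-involutive : ∀ s → opp (opp s) ≡ s
opp-involutive left  = refl
opp-involutive right = refl

choose-same : ∀ {A : Set} a (p q : A) → choose a p q a ≡ p
choose-same V p q = refl
choose-same X p q = refl
choose-same Y p q = refl

choose-≢ : ∀ {A : Set} {a ℓ} (p q : A) → a ≢ ℓ → choose a p q ℓ ≡ q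
choose-≢ {a = a} {ℓ} p q a≢ℓ with a ≟ˡ ℓ
... | yes a≡ℓ = contradiction a≡ℓ a≢ℓ
... | no  _   = refl

-- Chosen with 2 ^ e + low e + single e ≥ 4.
low single : ℕ → ℕ
low 0             = 2
low 1             = 2
low (suc (suc _)) = 0
single zero    = 1
single (suc _) = 0

Σ<-low : ∀ {n} → 2 ≤ n → Σ< n low ≡ 4
Σ<-low {suc (suc n)} (s≤s (s≤s _)) = cong (4 +_) (trans (Σ<-const n 0) (*-zeroʳ n))

Σ<-single : ∀ {n} → 1 ≤ n → Σ< n single ≡ 1
Σ<-single {suc n} (s≤s _) = cong suc (trans (Σ<-const n 0) (*-zeroʳ n))

1≤2^ : ∀ n → 1 ≤ 2 ^ n
1≤2^ n = m^n>0 2 n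

-- A recipe for one function per distinguished line: `main` is used on that line, `other` on the
-- remaining two, `spokes` on the row of the `z`.
record Scheme : Set where
  field
    main other spokes : Profile

open Scheme

pebblingBound : ℕ → ℕ
pebblingBound k = 6 * 2 ^ k + 2 * k + 1

-- Valid functions and certificates for the central roots

module Certificates (k : ℕ) (2≤k : 2 ≤ k) where

  open Weights k 2≤k
  open Graph (J m) using (Adj; adj-sym; Vertex)
  open Pebbling (J m) _≟_ᶠ

  spread : Scheme → Line → FlowerVertex m → ℕ
  spread T a = weight (choose a (main T) (other T)) (spokes T)

  -- Pebbles on the two other lines run to their centres, then through `z mid` to the root. The
  -- weights double at each step up to `2 * 2 ^ k`.
  schemeA : Scheme
  schemeA = record
    { main   = record { arm = λ _ _ → 0     ; centre = 0 }
    ; other  = record { arm = λ _ e → 2 ^ e ; centre = 2 ^ k }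
    ; spokes = record { arm = λ _ _ → 0     ; centre = 2 * 2 ^ k }
    }

  -- On side `s` the root's line doubles towards the root. Spokes of weight 4 feed that line, whose
  -- weights are at least 8; the two outermost vertices of each other line, of weight 2, feed the
  -- spokes; and the opposite ends of the other lines, of weight 1, feed across the closing edges.
  -- The last two kinds make up what `schemeA` lacks near the ends.
  schemeB : Side → Scheme
  schemeB s = record
    { main   = record { arm = on s (λ e → 8 * 2 ^ e) (λ _ → 0) ; centre = 0 }
    ; other  = record { arm = on s low single                  ; centre = 0 }
    ; spokes = record { arm = on s (λ _ → 4) (λ _ → 0)         ; centre = 0 }
    }

  -- The distinguished line doubles towards its centre, which is adjacent to the root `z mid`. The
  -- ends of the other lines, of weight 1, feed spokes of weight 2, and these feed the distinguished
  -- line, whose weights are at least 4.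
  schemeC : Scheme
  schemeC = record
    { main   = record { arm = λ _ e → 4 * 2 ^ e ; centre = 4 * 2 ^ k }
    ; other  = record { arm = λ _ → single      ; centre = 0 }
    ; spokes = record { arm = λ _ _ → 2         ; centre = 0 }
    }

  A C : Line → FlowerVertex m → ℕ
  A = spread schemeA
  C = spread schemeC

  B : Line → Side → FlowerVertex m → ℕ
  B a s = spread (schemeB s) a

  module _ (T : Scheme) (a : Line) where

    main-mid : spread T a (line a mid) ≡ centre (main T)
    main-mid = trans (weight-line-mid _ (spokes T) a) (cong centre (choose-same a (main T) (other T)))

    main-at : ∀ s {e i} → e < k → At s e i → spread T a (line a i) ≡ arm (main T) s e
    main-at s {e} e<k at = trans (weight-line-at _ (spokes T) a s e<k at)
      (cong (λ p → arm p s e) (choose-same a (main T) (other T)))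

    other-mid : ∀ {ℓ} → a ≢ ℓ → spread T a (line ℓ mid) ≡ centre (other T)
    other-mid {ℓ} a≢ℓ = trans (weight-line-mid _ (spokes T) ℓ)
      (cong centre (choose-≢ (main T) (other T) a≢ℓ))

    other-at : ∀ {ℓ} → a ≢ ℓ → ∀ s {e i} → e < k → At s e i →
               spread T a (line ℓ i) ≡ arm (other T) s e
    other-at {ℓ} a≢ℓ s {e} e<k at = trans (weight-line-at _ (spokes T) ℓ s e<k at)
      (cong (λ p → arm p s e) (choose-≢ (main T) (other T) a≢ℓ))

    z-mid : spread T a (z mid) ≡ centre (spokes T)
    z-mid = value-mid (spokes T)

    z-at : ∀ s {e i} → e < k → At s e i → spread T a (z i) ≡ arm (spokes T) s e
    z-at = value-at (spokes T)

  z-line : ∀ ℓ i → Adj (z i) (line ℓ i)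
  z-line ℓ i = edge⇒adj 2≤m (z-edge ℓ i)

  line-z : ∀ ℓ i → Adj (line ℓ i) (z i)
  line-z ℓ i = adj-sym (z-line ℓ i)

  -- Separates the final step onto the centre, where the weight is read from `centre` and no longer
  -- from an arm.
  inwards : ∀ s {e i} → e < k → At s e i → ∃[ j ] ((∀ ℓ → Adj (line ℓ i) (line ℓ j)) ×
            ((suc e < k × At s (suc e) j) ⊎ (suc e ≡ k × j ≡ mid)))
  inwards s e<k at with inner s e<k at | m≤n⇒m<n∨m≡n e<k
  ... | j , at′ , adj | inj₁ 1+e<k = j , adj , inj₁ (1+e<k , at′)
  ... | j , at′ , adj | inj₂ refl  = j , adj , inj₂ (refl , at-k s at′)

  double : ∀ c n → c * 2 ^ n + c * 2 ^ n ≤ c * 2 ^ suc n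
  double c n = ≤-reflexive (eq c (2 ^ n))
    where
    eq : ∀ c t → c * t + c * t ≡ c * (2 * t)
    eq = solve-∀

  A-valid : ∀ a → Valid (line a mid) (A a)
  A-valid a u with row u
  A-valid a _ | onZ i with position i
  ... | at-mid          = inj₂ (line a mid , z-line a mid , inj₁ refl)
  ... | at-arm s e<k at = inj₁ (z-at schemeA a s e<k at)
  A-valid a _ | onLine ℓ i with a ≟ˡ ℓ | position i
  ... | yes refl | at-mid          = inj₁ (main-mid schemeA a)
  ... | yes refl | at-arm s e<k at = inj₁ (main-at schemeA a s e<k at)
  ... | no a≢ℓ   | at-mid          =
    feed (line a mid) (line-z ℓ mid) (other-mid schemeA a a≢ℓ) (z-mid schemeA a)
      (≤-reflexive (cong (2 ^ k +_) (sym (+-identityʳ (2 ^ k)))))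
  ... | no a≢ℓ   | at-arm s {e} e<k at with inwards s e<k at
  ...   | j , adj , inj₁ (1+e<k , at′) =
    feed (line a mid) (adj ℓ) (other-at schemeA a a≢ℓ s e<k at) (other-at schemeA a a≢ℓ s 1+e<k at′)
      (≤-reflexive (cong (2 ^ e +_) (sym (+-identityʳ (2 ^ e)))))
  ...   | j , adj , inj₂ (refl , refl) =
    feed (line a mid) (adj ℓ) (other-at schemeA a a≢ℓ s e<k at) (other-mid schemeA a a≢ℓ)
      (≤-reflexive (cong (2 ^ e +_) (sym (+-identityʳ (2 ^ e)))))

  -- A closing edge may lead onto the root's line or onto another one. The end weights there are 8
  -- and 2, both enough for an opposite end of weight 1.
  B-cross : ∀ a s ℓ {i} → At s 0 i → 2 ≤ B a s (line ℓ i)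
  B-cross a s ℓ at with a ≟ˡ ℓ
  ... | yes refl = ≤-trans (m≤m+n 2 6) (≤-reflexive (sym (trans
    (main-at (schemeB s) a s (<⇒≤ 2≤k) at) (cong (_$ 0) (on-same s (λ e → 8 * 2 ^ e) (λ _ → 0))))))
  ... | no a≢ℓ   = ≤-reflexive (sym (trans
    (other-at (schemeB s) a a≢ℓ s (<⇒≤ 2≤k) at) (cong (_$ 0) (on-same s low single))))

  module _ (a : Line) {s : Side} {e : ℕ} {i : Fin m} (e<k : e < k) (at : At s e i) where

    B-same : B a s (line a i) ≡ 8 * 2 ^ e
    B-same = trans (main-at (schemeB s) a s e<k at) (cong (_$ e) (on-same s (λ e → 8 * 2 ^ e) (λ _ → 0)))

    B-other : ∀ {ℓ} → a ≢ ℓ → B a s (line ℓ i) ≡ low e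
    B-other a≢ℓ = trans (other-at (schemeB s) a a≢ℓ s e<k at) (cong (_$ e) (on-same s low single))

    B-z : B a s (z i) ≡ 4
    B-z = trans (z-at (schemeB s) a s e<k at) (cong (_$ e) (on-same s (λ _ → 4) (λ _ → 0)))

  module _ (a : Line) {s : Side} {e : ℕ} {i : Fin m} (e<k : e < k) (at : At (opp s) e i) where

    B-same-opp : B a s (line a i) ≡ 0
    B-same-opp = trans (main-at (schemeB s) a (opp s) e<k at) (cong (_$ e) (on-opp s (λ e → 8 * 2 ^ e) (λ _ → 0)))

    B-other-opp : ∀ {ℓ} → a ≢ ℓ → B a s (line ℓ i) ≡ single e
    B-other-opp a≢ℓ = trans (other-at (schemeB s) a a≢ℓ (opp s) e<k at) (cong (_$ e) (on-opp s low single))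

    B-z-opp : B a s (z i) ≡ 0
    B-z-opp = trans (z-at (schemeB s) a (opp s) e<k at) (cong (_$ e) (on-opp s (λ _ → 4) (λ _ → 0)))

  B-valid : ∀ a s → Valid (line a mid) (B a s)
  B-valid a s u with row u
  B-valid a s _ | onZ i with position i
  ... | at-mid              = inj₁ (z-mid (schemeB s) a)
  ... | at-arm t {e} e<k at with side s t
  ...   | inj₂ refl = inj₁ (B-z-opp a e<k at)
  ...   | inj₁ refl = feed (line a mid) (z-line a i) (B-z a e<k at) (B-same a e<k at) (*-monoʳ-≤ 8 (1≤2^ e))
  B-valid a s _ | onLine ℓ i with a ≟ˡ ℓ | position i
  ... | yes refl | at-mid = inj₁ (main-mid (schemeB s) a)
  ... | no a≢ℓ   | at-mid = inj₁ (other-mid (schemeB s) a a≢ℓ)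
  ... | yes refl | at-arm t {e} e<k at with side s t
  ...   | inj₂ refl = inj₁ (B-same-opp a e<k at)
  ...   | inj₁ refl with inwards s e<k at
  ...     | j , adj , inj₁ (1+e<k , at′) =
    feed (line a mid) (adj a) (B-same a e<k at) (B-same a 1+e<k at′) (double 8 e)
  -- The neighbour is the root itself, so its weight 0 does no harm.
  ...     | j , adj , inj₂ (_ , j≡mid)   = inj₂ (line a j , adj a , inj₁ (cong (line a) j≡mid))
  B-valid a s _ | onLine ℓ i | no a≢ℓ | at-arm t {e} e<k at with side s t | e
  ...   | inj₁ refl | 0             = feed (line a mid) (line-z ℓ i) (B-other a e<k at a≢ℓ) (B-z a e<k at) ≤-refl
  ...   | inj₁ refl | 1             = feed (line a mid) (line-z ℓ i) (B-other a e<k at a≢ℓ) (B-z a e<k at) ≤-refl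
  ...   | inj₁ refl | suc (suc _)   = inj₁ (B-other a e<k at a≢ℓ)
  ...   | inj₂ refl | suc _         = inj₁ (B-other-opp a e<k at a≢ℓ)
  ...   | inj₂ refl | 0 with across (opp s) at
  ...     | j , at′ , adj =
    -- Crossing from the end of `opp s` lands on `opp (opp s)`, that is, on side `s`.
    feed (line a mid) (adj ℓ) (B-other-opp a e<k at a≢ℓ) refl
      (B-cross a s (cross ℓ) (subst (λ t → At t 0 j) (opp-involutive s) at′))

  C-valid : ∀ a → Valid (z mid) (C a)
  C-valid a u with row u
  C-valid a _ | onZ i with position i
  ... | at-mid              = inj₁ (z-mid schemeC a)
  ... | at-arm s {e} e<k at =
    feed (z mid) (z-line a i) (z-at schemeC a s e<k at) (main-at schemeC a s e<k at) (*-monoʳ-≤ 4 (1≤2^ e))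
  C-valid a _ | onLine ℓ i with a ≟ˡ ℓ | position i
  ... | yes refl | at-mid = inj₂ (z mid , line-z a mid , inj₁ refl)
  ... | no a≢ℓ   | at-mid = inj₁ (other-mid schemeC a a≢ℓ)
  ... | yes refl | at-arm s {e} e<k at with inwards s e<k at
  ...   | j , adj , inj₁ (1+e<k , at′) =
    feed (z mid) (adj a) (main-at schemeC a s e<k at) (main-at schemeC a s 1+e<k at′) (double 4 e)
  ...   | j , adj , inj₂ (refl , refl) =
    feed (z mid) (adj a) (main-at schemeC a s e<k at) (main-mid schemeC a) (double 4 e)
  C-valid a _ | onLine ℓ i | no a≢ℓ | at-arm s {e} e<k at with e
  ...   | zero  = feed (z mid) (line-z ℓ i) (other-at schemeC a a≢ℓ s e<k at) (z-at schemeC a s e<k at) ≤-refl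
  ...   | suc _ = inj₁ (other-at schemeC a a≢ℓ s e<k at)

  S : ℕ
  S = Σ< k (2 ^_)

  Σ<-0 : Σ< k (λ _ → 0) ≡ 0
  Σ<-0 = trans (Σ<-const k 0) (*-zeroʳ k)

  mass-on : ∀ s f g c → mass (record { arm = on s f g ; centre = c }) ≡ Σ< k f + (c + Σ< k g)
  mass-on left  f g c = refl
  mass-on right f g c = swap-ends (Σ< k g) c (Σ< k f)
    where
    swap-ends : ∀ p q r → p + (q + r) ≡ r + (q + p)
    swap-ends = solve-∀

  size-spread : ∀ T a → size (J m) (spread T a) ≡
                mass (main T) + (mass (other T) + (mass (other T) + mass (spokes T)))
  size-spread T a = trans (size-weight (choose a (main T) (other T)) (spokes T)) (reorder a)
    where
    left-comm : ∀ p q r → p + (q + r) ≡ q + (p + r)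
    left-comm = solve-∀
    p = mass (main T)
    q = mass (other T)
    r = mass (spokes T)
    chosen : Line → Line → ℕ
    chosen a ℓ = mass (choose a (main T) (other T) ℓ)
    reorder : ∀ a → chosen a V + (chosen a X + (chosen a Y + r)) ≡ p + (q + (q + r))
    reorder V = refl
    reorder X = left-comm q p (q + r)
    reorder Y = trans (cong (q +_) (left-comm q p r)) (left-comm q p (q + r))

  size-A : ∀ a → size (J m) (A a) ≡ 8 * S + 4
  size-A a = begin
    size (J m) (A a)
      ≡⟨ size-spread schemeA a ⟩
    (Σ< k (λ _ → 0) + Σ< k (λ _ → 0)) +
    ((S + (2 ^ k + S)) + ((S + (2 ^ k + S)) + (Σ< k (λ _ → 0) + (2 * 2 ^ k + Σ< k (λ _ → 0)))))
      ≡⟨ cong₂ (λ o t → (o + o) + ((S + (t + S)) + ((S + (t + S)) + (o + (2 * t + o))))) Σ<-0 (sym (Σ<-2^ k)) ⟩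
    (S + (suc S + S)) + ((S + (suc S + S)) + (2 * suc S + 0))
      ≡⟨ eq S ⟩
    8 * S + 4 ∎
    where
    open ≡-Reasoning
    eq : ∀ s → (s + (suc s + s)) + ((s + (suc s + s)) + (2 * suc s + 0)) ≡ 8 * s + 4
    eq = solve-∀

  size-B : ∀ a s → size (J m) (B a s) ≡ 8 * S + 4 * k + 10
  size-B a s = begin
    size (J m) (B a s)
      ≡⟨ size-spread (schemeB s) a ⟩
    _ ≡⟨ cong₂ _+_ (mass-on s _ _ 0) (cong₂ (λ p q → p + (p + q)) (mass-on s low single 0) (mass-on s _ _ 0)) ⟩
    (Σ< k (λ e → 8 * 2 ^ e) + Σ< k (λ _ → 0)) +
    ((Σ< k low + Σ< k single) + ((Σ< k low + Σ< k single) + (Σ< k (λ _ → 4) + Σ< k (λ _ → 0))))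
      ≡⟨ cong₂ _+_ (cong₂ _+_ (Σ<-* k 8 (2 ^_)) Σ<-0)
           (cong₂ (λ p q → p + (p + q)) (cong₂ _+_ (Σ<-low 2≤k) (Σ<-single (<⇒≤ 2≤k)))
             (cong₂ _+_ (Σ<-const k 4) Σ<-0)) ⟩
    (8 * S + 0) + (5 + (5 + (k * 4 + 0)))
      ≡⟨ eq S k ⟩
    8 * S + 4 * k + 10 ∎
    where
    open ≡-Reasoning
    eq : ∀ s k → (8 * s + 0) + (5 + (5 + (k * 4 + 0))) ≡ 8 * s + 4 * k + 10
    eq = solve-∀

  size-C : ∀ a → size (J m) (C a) ≡ 12 * S + 4 * k + 8
  size-C a = begin
    size (J m) (C a)
      ≡⟨ size-spread schemeC a ⟩
    (Σ< k (λ e → 4 * 2 ^ e) + (4 * 2 ^ k + Σ< k (λ e → 4 * 2 ^ e))) +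
    ((Σ< k single + Σ< k single) + ((Σ< k single + Σ< k single) + (Σ< k (λ _ → 2) + Σ< k (λ _ → 2))))
      ≡⟨ cong₂ _+_ (cong₂ (λ p t → p + (4 * t + p)) (Σ<-* k 4 (2 ^_)) (sym (Σ<-2^ k)))
           (cong₂ (λ p q → (p + p) + ((p + p) + (q + q))) (Σ<-single (<⇒≤ 2≤k)) (Σ<-const k 2)) ⟩
    (4 * S + (4 * suc S + 4 * S)) + (2 + (2 + (k * 2 + k * 2)))
      ≡⟨ eq S k ⟩
    12 * S + 4 * k + 8 ∎
    where
    open ≡-Reasoning
    eq : ∀ s k → (4 * s + (4 * suc s + 4 * s)) + (2 + (2 + (k * 2 + k * 2))) ≡ 12 * s + 4 * k + 8
    eq = solve-∀

  size-⊕ : ∀ f g → size (J m) (λ u → f u + g u) ≡ size (J m) f + size (J m) g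
  size-⊕ f g = sum-map-+ f g (flowerVertices m)

  both-sides : ∀ s (f : Side → ℕ) → f left + f right ≡ f s + f (opp s)
  both-sides left  f = refl
  both-sides right f = +-comm (f left) (f right)

  certificate-line : ∀ a → Certificate (line a mid) (pebblingBound k)
  certificate-line a = record
    { weight   = λ u → A a u + (B a left u + B a right u)
    ; strategy = valid (A-valid a) ⊕ (valid (B-valid a left) ⊕ valid (B-valid a right))
    ; scale    = 4
    ; covers   = covers
    ; total    = begin-strict
        size (J m) (λ u → A a u + (B a left u + B a right u))
          ≡⟨ size-⊕ (A a) _ ⟩
        size (J m) (A a) + size (J m) (λ u → B a left u + B a right u)
          ≡⟨ cong₂ _+_ (size-A a) (trans (size-⊕ (B a left) (B a right)) (cong₂ _+_ (size-B a left) (size-B a right))) ⟩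
        (8 * S + 4) + ((8 * S + 4 * k + 10) + (8 * S + 4 * k + 10))
          -- The total weight is exactly `4 * (6 * 2 ^ k + 2 * k)`; the gap 4 is the scale times the
          -- `+ 1` in `pebblingBound`.
          <⟨ m<m+n _ {4} z<s ⟩
        (8 * S + 4) + ((8 * S + 4 * k + 10) + (8 * S + 4 * k + 10)) + 4
          ≡⟨ eq S k ⟩
        4 * (6 * suc S + 2 * k + 1)
          ≡⟨ cong (λ t → 4 * (6 * t + 2 * k + 1)) (Σ<-2^ k) ⟩
        4 * pebblingBound k ∎
    }
    where
    open ≤-Reasoning
    eq : ∀ s k → (8 * s + 4) + ((8 * s + 4 * k + 10) + (8 * s + 4 * k + 10)) + 4 ≡ 4 * (6 * suc s + 2 * k + 1)
    eq = solve-∀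
    Bs : FlowerVertex m → Side → ℕ
    Bs u s = B a s u
    W : FlowerVertex m → ℕ
    W u = A a u + (B a left u + B a right u)
    A≤ : ∀ u → A a u ≤ W u
    A≤ u = m≤m+n (A a u) _
    B≤ : ∀ s u → B a s u ≤ W u
    B≤ s u = ≤-trans (m≤m+n (B a s u) (B a (opp s) u))
      (≤-trans (≤-reflexive (sym (both-sides s (Bs u)))) (m≤n+m _ (A a u)))
    4≤2^ : ∀ {n} → 2 ≤ n → 4 ≤ 2 ^ n
    4≤2^ = ^-monoʳ-≤ 2
    ends : ∀ e → 4 ≤ 2 ^ e + (low e + single e)
    ends 0             = ≤-refl
    ends 1             = ≤-refl
    ends (suc (suc e)) = ≤-trans (4≤2^ {2 + e} (s≤s (s≤s z≤n))) (m≤m+n _ 0)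
    -- `A` alone covers `z mid` and the centres of the other lines, since `4 ≤ 2 ^ k`. `B` on the
    -- side of the vertex covers the remaining spokes and the root's line.
    covers : ∀ u → u ≢ line a mid → 4 ≤ W u
    covers u u≢r with row u
    covers _ _   | onZ i with position i
    ... | at-mid          = ≤-trans (4≤2^ 2≤k) (≤-trans (m≤n*m (2 ^ k) 2)
      (≤-trans (≤-reflexive (sym (z-mid schemeA a))) (A≤ (z mid))))
    ... | at-arm s e<k at = ≤-trans (≤-reflexive (sym (B-z a e<k at))) (B≤ s (z i))
    covers _ u≢r | onLine ℓ i with a ≟ˡ ℓ | position i
    ... | yes refl | at-mid = contradiction refl u≢r
    ... | no a≢ℓ   | at-mid = ≤-trans (4≤2^ 2≤k)
      (≤-trans (≤-reflexive (sym (other-mid schemeA a a≢ℓ))) (A≤ (line ℓ mid)))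
    ... | yes refl | at-arm s {e} e<k at = begin
      4              ≤⟨ m≤m+n 4 4 ⟩
      8 * 1          ≤⟨ *-monoʳ-≤ 8 (1≤2^ e) ⟩
      8 * 2 ^ e      ≡⟨ B-same a e<k at ⟨
      B a s (line a i) ≤⟨ B≤ s (line a i) ⟩
      W (line a i)   ∎
    -- Here all three functions are added: the end gets 1 + 2 + 1, its neighbour 2 + 2 + 0, and
    -- further in `2 ^ e` suffices.
    ... | no a≢ℓ   | at-arm s {e} e<k at = begin
      4                              ≤⟨ ends e ⟩
      2 ^ e + (low e + single e)
        ≡⟨ cong₂ _+_ (other-at schemeA a a≢ℓ s e<k at) (cong₂ _+_ (B-other a e<k at a≢ℓ)
             (B-other-opp a e<k (subst (λ t → At t e i) (sym (opp-involutive s)) at) a≢ℓ)) ⟨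
      A a (line ℓ i) + (B a s (line ℓ i) + B a (opp s) (line ℓ i))
        ≡⟨ cong (A a (line ℓ i) +_) (both-sides s (Bs (line ℓ i))) ⟨
      W (line ℓ i)                   ∎

  certificate-z : Certificate (z mid) (pebblingBound k)
  certificate-z = record
    { weight   = W
    ; strategy = valid (C-valid V) ⊕ (valid (C-valid X) ⊕ valid (C-valid Y))
    ; scale    = 6
    ; covers   = covers
    ; total    = begin-strict
        size (J m) W
          ≡⟨ size-⊕ (C V) _ ⟩
        size (J m) (C V) + size (J m) (λ u → C X u + C Y u)
          ≡⟨ cong₂ _+_ (size-C V) (trans (size-⊕ (C X) (C Y)) (cong₂ _+_ (size-C X) (size-C Y))) ⟩
        (12 * S + 4 * k + 8) + ((12 * S + 4 * k + 8) + (12 * S + 4 * k + 8))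
          -- Of the gap 18, 6 comes from the `+ 1` in `pebblingBound`; the remaining 12 is slack.
          <⟨ m<m+n _ {18} z<s ⟩
        (12 * S + 4 * k + 8) + ((12 * S + 4 * k + 8) + (12 * S + 4 * k + 8)) + 18
          ≡⟨ eq S k ⟩
        6 * (6 * suc S + 2 * k + 1)
          ≡⟨ cong (λ t → 6 * (6 * t + 2 * k + 1)) (Σ<-2^ k) ⟩
        6 * pebblingBound k ∎
    }
    where
    open ≤-Reasoning
    eq : ∀ s k → (12 * s + 4 * k + 8) + ((12 * s + 4 * k + 8) + (12 * s + 4 * k + 8)) + 18 ≡ 6 * (6 * suc s + 2 * k + 1)
    eq = solve-∀
    W : FlowerVertex m → ℕ
    W u = C V u + (C X u + C Y u)
    -- `W` adds the functions in the fixed order V, X, Y. Bringing that of `ℓ` to the front allows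
    -- one estimate for all three lines.
    around : ∀ ℓ u {p q} → C ℓ u ≡ p → (∀ a → a ≢ ℓ → C a u ≡ q) → W u ≡ p + (q + q)
    around V u main other = cong₂ _+_ main (cong₂ _+_ (other X λ ()) (other Y λ ()))
    around X u {p} {q} main other =
      trans (cong₂ _+_ (other V λ ()) (cong₂ _+_ main (other Y λ ()))) (rot q p)
      where rot : ∀ q p → q + (p + q) ≡ p + (q + q)
            rot = solve-∀
    around Y u {p} {q} main other =
      trans (cong₂ _+_ (other V λ ()) (cong₂ _+_ (other X λ ()) main)) (rot q p)
      where rot : ∀ q p → q + (q + p) ≡ p + (q + q)
            rot = solve-∀
    ends : ∀ e → 6 ≤ 4 * 2 ^ e + (single e + single e)
    ends zero    = ≤-refl
    ends (suc e) = ≤-trans (≤-trans (m≤m+n 6 2) (*-monoʳ-≤ 4 (*-monoʳ-≤ 2 (1≤2^ e)))) (m≤m+n _ 0)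
    covers : ∀ u → u ≢ z mid → 6 ≤ W u
    covers u u≢r with row u
    covers _ u≢r | onZ i with position i
    ... | at-mid          = contradiction refl u≢r
    -- All three functions equal 2 on this spoke, so the choice of `V` is arbitrary.
    ... | at-arm s e<k at = ≤-reflexive (sym (around V (z i)
      (z-at schemeC V s e<k at) (λ a _ → z-at schemeC a s e<k at)))
    covers _ _   | onLine ℓ i with position i
    ... | at-mid = begin
      6                    ≤⟨ m≤m+n 6 2 ⟩
      4 * 2                ≤⟨ *-monoʳ-≤ 4 (^-monoʳ-≤ 2 (<⇒≤ 2≤k)) ⟩
      4 * 2 ^ k            ≤⟨ m≤m+n _ 0 ⟩
      4 * 2 ^ k + 0        ≡⟨ around ℓ (line ℓ mid) (main-mid schemeC ℓ) (λ a a≢ℓ → other-mid schemeC a a≢ℓ) ⟨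
      W (line ℓ mid)       ∎
    ... | at-arm s {e} e<k at = begin
      6                    ≤⟨ ends e ⟩
      4 * 2 ^ e + (single e + single e)
        ≡⟨ around ℓ (line ℓ i) (main-at schemeC ℓ s e<k at) (λ a a≢ℓ → other-at schemeC a a≢ℓ s e<k at) ⟨
      W (line ℓ i)         ∎

-- From central roots to all roots

flower-certificates : ∀ k → 2 ≤ k → ∀ r →
  Pebbling.Certificate (J (suc (k + k))) _≟_ᶠ r (pebblingBound k)
-- With `k` a successor, `suc (k + k)` is `suc (suc (j + k))`, the form of `m` that `Rotation` uses.
flower-certificates k@(suc j) 2≤k = at-all (m≤m+n k k) central
  where
  open Rotation (j + k)
  open Weights k 2≤k
  open Certificates k 2≤k

  central : CertificatesAt k
  central u i≡k with row u
  ... | onLine V i with refl ← at-k left i≡k = certificate-line V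
  ... | onLine X i with refl ← at-k left i≡k = certificate-line X
  ... | onLine Y i with refl ← at-k left i≡k = certificate-line Y
  ... | onZ i      with refl ← at-k left i≡k = certificate-z

flower-pebbling : ∀ k → 2 ≤ k →
  ∃[ t ] (IsPebblingNumber (J (suc (k + k))) t × t ≤ pebblingBound k)
flower-pebbling k 2≤k =
  Pebbling.pebblingNumber≤ (J (suc (k + k))) _≟_ᶠ adj? (flower-certificates k 2≤k)

-- Opened only here: with +_ in scope, the sections (n +_) above are ambiguous.
open import Data.Integer.Base using (+_)

-- Comparison with the rational bound

≤-floor : ∀ n p → n ℤ.* ↧ p ℤ.≤ ↥ p → n ℤ.≤ floor p
≤-floor n p@record{} n*↧p≤↥p = subst (n ℤ.≤_) (sym (ℤ.div-pos-is-/ℕ (↥ p) (ℚᵘ.↧ₙ p)))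
  (subst (n ℤ.≤_) (ℤ.pred-suc _) (ℤ.i<j⇒i≤pred[j] n<1+q))
  where
  n<1+q : n ℤ.< ℤ.suc (↥ p ℤ./ℕ ℚᵘ.↧ₙ p)
  -- Division with remainder puts the numerator strictly below quotient plus one times the
  -- denominator.
  n<1+q = ℤ.*-cancelʳ-<-nonNeg (↧ p) (ℤ.≤-<-trans n*↧p≤↥p (ℤ.n<s[n/ℕd]*d (↥ p) (ℚᵘ.↧ₙ p)))

-- The number under the floor exceeds `6 * 2 ^ k + 2 * k` by (2/5)(2^k - 4), which is nonnegative
-- for `k` at least 2 and zero at 2.
pebblingBound≤flowerBound : ∀ k → 2 ≤ k → + pebblingBound k ℤ.≤ flowerBound k
pebblingBound≤flowerBound k 2≤k = ℤ.+-monoˡ-≤ (+ 1)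
  (≤-floor (+ M) (q (+ (2 ^ (k + 2))) (+ (2 * k))) M*25≤)
  where
  M = 6 * 2 ^ k + 2 * k

  q : ℤ → ℤ → ℚᵘ
  q i j = (+ 8 ℚᵘ./ 5) ℚᵘ.* (i ℚᵘ./ 1) ℚᵘ.+ (j ℚᵘ./ 1) ℚᵘ.- (+ 8 ℚᵘ./ 5)

  -- Unnormalised arithmetic cancels nothing: the denominator of `q i j` is 5 · 1 · 1 · 5 = 25,
  -- hence the factor 25 on `M`.
  numerator : ∀ i j → (+ 8 ℤ.* i ℤ.* + 1 ℤ.+ j ℤ.* + 5) ℤ.* + 5 ℤ.+ ℤ.- (+ 8) ℤ.* + 5
                      ≡ + 40 ℤ.* i ℤ.+ + 25 ℤ.* j ℤ.+ ℤ.- (+ 40)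
  numerator = ℤ-Solver.solve-∀

  expand : ∀ t k → (6 * t + 2 * k) * 25 + 40 + 10 * t ≡ 40 * (t * 4) + 25 * (2 * k) + 40
  expand = solve-∀

  M*25+40≤ℕ : M * 25 + 40 ≤ 40 * 2 ^ (k + 2) + 25 * (2 * k)
  -- The 40 added on the left is `10 * 2 ^ 2`, at most `10 * 2 ^ k`; this is the excess of 160 · 2^k
  -- over 150 · 2^k.
  M*25+40≤ℕ = +-cancelʳ-≤ 40 _ _ (begin
    M * 25 + 40 + 10 * 2 ^ 2                    ≤⟨ +-monoʳ-≤ (M * 25 + 40) (*-monoʳ-≤ 10 (^-monoʳ-≤ 2 2≤k)) ⟩
    M * 25 + 40 + 10 * 2 ^ k                    ≡⟨ expand (2 ^ k) k ⟩
    40 * (2 ^ k * 4) + 25 * (2 * k) + 40        ≡⟨ cong (λ t → 40 * t + 25 * (2 * k) + 40) (^-distribˡ-+-* 2 k 2) ⟨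
    40 * 2 ^ (k + 2) + 25 * (2 * k) + 40        ∎)
    where open ≤-Reasoning

  cancel : ∀ i → i ≡ i ℤ.+ + 40 ℤ.+ ℤ.- (+ 40)
  cancel = ℤ-Solver.solve-∀

  M*25≤ : + M ℤ.* + 25 ℤ.≤ ↥ q (+ (2 ^ (k + 2))) (+ (2 * k))
  M*25≤ = begin
    + M ℤ.* + 25
      ≡⟨ ℤ.pos-* M 25 ⟨
    + (M * 25)
      ≡⟨ cancel (+ (M * 25)) ⟩
    + (M * 25 + 40) ℤ.+ ℤ.- (+ 40)
      ≤⟨ ℤ.+-monoˡ-≤ (ℤ.- (+ 40)) (ℤ.+≤+ M*25+40≤ℕ) ⟩
    + (40 * 2 ^ (k + 2)) ℤ.+ + (25 * (2 * k)) ℤ.+ ℤ.- (+ 40)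
      ≡⟨ cong (ℤ._+ ℤ.- (+ 40)) (cong₂ ℤ._+_ (ℤ.pos-* 40 (2 ^ (k + 2))) (ℤ.pos-* 25 (2 * k))) ⟩
    + 40 ℤ.* + (2 ^ (k + 2)) ℤ.+ + 25 ℤ.* + (2 * k) ℤ.+ ℤ.- (+ 40)
      ≡⟨ numerator (+ (2 ^ (k + 2))) (+ (2 * k)) ⟨
    ↥ q (+ (2 ^ (k + 2))) (+ (2 * k)) ∎
    where open ℤ.≤-Reasoning

theorem3p2 : (∀ (m k : ℕ) → m ≡ 2 * k + 1 → m ≥ 5 →
    ∃[ t ] (IsPebblingNumber (J m) t × + t ℤ.≤ flowerBound k))
    × (∃[ t ] (IsPebblingNumber (J 5) t × t ≤ 29))
    × (∃[ t ] (IsPebblingNumber (J 7) t × t ≤ 56))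
-- `pebblingBound` evaluates to 29 at 2, as claimed, and to 55 at 3, one less than claimed.
theorem3p2 = general , flower-pebbling 2 ≤-refl , J7
  where
  general : ∀ (m k : ℕ) → m ≡ 2 * k + 1 → m ≥ 5 →
            ∃[ t ] (IsPebblingNumber (J m) t × + t ℤ.≤ flowerBound k)
  general m k m≡2k+1 m≥5 =
    let t , t-pebbling , t≤ = flower-pebbling k 2≤k in
    t , subst (λ n → IsPebblingNumber (J n) t) (sym m≡) t-pebbling ,
    ℤ.≤-trans (ℤ.+≤+ t≤) (pebblingBound≤flowerBound k 2≤k)
    where
    m≡ : m ≡ suc (k + k)
    m≡ = trans m≡2k+1 (double+1 k)
      where
      double+1 : ∀ k → 2 * k + 1 ≡ suc (k + k)
      double+1 = solve-∀
    2≤k : 2 ≤ k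
    2≤k = *-cancelˡ-≤ 2 (+-cancelʳ-≤ 1 4 (2 * k) (subst (5 ≤_) m≡2k+1 m≥5))

  J7 : ∃[ t ] (IsPebblingNumber (J 7) t × t ≤ 56)
  J7 = let t , t-pebbling , t≤55 = flower-pebbling 3 (s≤s (s≤s z≤n)) in
       t , t-pebbling , ≤-trans t≤55 (n≤1+n 55)
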